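{- For any $t \geq 0$, \textsc{1-Edge Contraction($\gamma_{t2}$)} is polynomial-time solvable on $(P_5 + tK_1)$-free graphs.
   Context: All graphs are finite, simple and connected. A semitotal dominating set of $G$ is a set $D\subseteq V(G)$ such that every vertex outside $D$ has a neighbour in $D$ and every vertex of $D$ is at distance at most two from another vertex of $D$; $\gamma_{t2}(G)$ is its minimum size. $ct_{\gamma_{t2}}(G)$ is the smallest $k$ such that contracting some $k$ edges of $G$ (contracting $uv$ replaces $u,v$ by one vertex adjacent to all neighbours of $u$ or $v$) yields $G'$ with $\gamma_{t2}(G')<\gamma_{t2}(G)$. \textsc{1-Edge Contraction($\gamma_{t2}$)}: given $G$, decide whether $ct_{\gamma_{t2}}(G)\leq 1$. $P_5+tK_1$ is the disjoint union of a path on five vertices and $t$ isolated vertices. -}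

module Defs where

open import Data.Bool using (Bool; true; false; T; if_then_else_)
open import Data.Bool.Properties using (T?)
open import Data.Empty using (⊥)
open import Data.Fin using (Fin; toℕ; punchIn; splitAt)
import Data.Fin as Fin
open import Data.Fin.Subset using (Subset; _∈_; _∉_; ∣_∣)
open import Data.List using (List; []; _∷_; _++_; length; replicate; concat; tabulate)
open import Data.Nat using (ℕ; zero; suc; _+_; _*_; _∸_; _^_; _≤_; _<_; _≟_; _≡ᵇ_)
open import Data.Nat.Properties using (1+n≢n)
open import Data.Product using (∃; ∃-syntax; Σ-syntax; _×_; _,_)
open import Data.Sum using (_⊎_; inj₁; inj₂; swap)
open import Data.Sum.Relation.Binary.Pointwise using (Pointwise; ⊎-symmetric; ⊎-decidable; inj₁; inj₂)
open import Function using (Injective; _⇔_)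
open import Relation.Binary using (Rel; Decidable; Symmetric)
open import Relation.Binary.PropositionalEquality using (_≡_; _≢_; refl; sym)
open import Relation.Nullary using (¬_; no; ¬?; _×-dec_; _⊎-dec_; ⌊_⌋; toWitness; fromWitness)
open import Level using (0ℓ)

record Graph (n : ℕ) : Set where
  field
    adj : Fin n → Fin n → Bool

  _~_ : Rel (Fin n) 0ℓ
  u ~ v = T (adj u v)

  field
    symmetric   : Symmetric _~_
    irreflexive : ∀ v → ¬ (v ~ v)

  _~?_ : Decidable _~_
  u ~? v = T? (adj u v)

fromRelation : ∀ {n} (R : Rel (Fin n) 0ℓ) → Decidable R →
               Symmetric R → (∀ v → ¬ R v v) → Graph n
fromRelation R R? R-sym R-irrefl = record
  { adj         = λ u v → ⌊ R? u v ⌋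
  ; symmetric   = λ {u} {v} p →
      fromWitness {a? = R? v u} (R-sym (toWitness {a? = R? u v} p))
  ; irreflexive = λ v p → R-irrefl v (toWitness {a? = R? v v} p)
  }

pathGraph : ∀ n → Graph n
pathGraph n = fromRelation
  (λ i j → suc (toℕ i) ≡ toℕ j ⊎ suc (toℕ j) ≡ toℕ i)
  (λ i j → (suc (toℕ i) ≟ toℕ j) ⊎-dec (suc (toℕ j) ≟ toℕ i))
  swap
  λ { i (inj₁ p) → 1+n≢n p ; i (inj₂ p) → 1+n≢n p }

edgeless : ∀ n → Graph n
edgeless n = fromRelation (λ _ _ → ⊥) (λ _ _ → no λ ()) (λ ()) (λ _ ())

disjointUnion : ∀ {m n} → Graph m → Graph n → Graph (m + n)
disjointUnion {m} {n} G H = fromRelation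
  (λ i j → R (splitAt m i) (splitAt m j))
  (λ i j → ⊎-decidable G._~?_ H._~?_ (splitAt m i) (splitAt m j))
  (⊎-symmetric {R = G._~_} {S = H._~_} G.symmetric H.symmetric)
  (λ i → R-irrefl (splitAt m i))
  where
  module G = Graph G
  module H = Graph H
  R = Pointwise G._~_ H._~_
  R-irrefl : ∀ x → ¬ R x x
  R-irrefl (inj₁ u) (inj₁ p) = G.irreflexive u p
  R-irrefl (inj₂ v) (inj₂ p) = H.irreflexive v p

P₅+_K₁ : ∀ t → Graph (5 + t)
P₅+ t K₁ = disjointUnion (pathGraph 5) (edgeless t)

InducedSubgraph : ∀ {m n} → Graph m → Graph n → Set
InducedSubgraph {m} {n} H G =
  Σ[ f ∈ (Fin m → Fin n) ]
    Injective _≡_ _≡_ f × (∀ i j → Graph._~_ H i j ⇔ Graph._~_ G (f i) (f j))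

Free : ∀ {m n} → Graph m → Graph n → Set
Free H G = ¬ InducedSubgraph H G

data Walk {n} (G : Graph n) : Fin n → Fin n → ℕ → Set where
  stop : ∀ {v} → Walk G v v 0
  step : ∀ {u v w k} → Graph._~_ G u v → Walk G v w k → Walk G u w (suc k)

DistanceAtMost : ∀ {n} → Graph n → ℕ → Fin n → Fin n → Set
DistanceAtMost G d u v = ∃[ k ] k ≤ d × Walk G u v k

Connected : ∀ {n} → Graph n → Set
Connected {n} G = 0 < n × (∀ u v → ∃[ k ] Walk G u v k)

-- G / uv has vertex set V(G) ∖ {v}, embedded in V(G) by punchIn v; the vertex u
-- plays the role of the merged vertex. The clause i ≢ j discards the loop that
-- the edge uv would otherwise leave behind.
module _ {n} (G : Graph (suc n)) (u v : Fin (suc n)) where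
  open Graph G

  ContractAdj : Rel (Fin n) 0ℓ
  ContractAdj i j =
    i ≢ j ×
    (punchIn v i ~ punchIn v j
      ⊎ (punchIn v i ≡ u × v ~ punchIn v j)
      ⊎ (punchIn v j ≡ u × v ~ punchIn v i))

  contractAdj? : Decidable ContractAdj
  contractAdj? i j =
    ¬? (i Fin.≟ j) ×-dec
    ((punchIn v i ~? punchIn v j)
      ⊎-dec ((punchIn v i Fin.≟ u) ×-dec (v ~? punchIn v j))
      ⊎-dec ((punchIn v j Fin.≟ u) ×-dec (v ~? punchIn v i)))

  contractAdj-sym : Symmetric ContractAdj
  contractAdj-sym (i≢j , inj₁ p) = (λ e → i≢j (sym e)) , inj₁ (symmetric p)
  contractAdj-sym (i≢j , inj₂ p) = (λ e → i≢j (sym e)) , inj₂ (swap p)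

  contract : Graph n
  contract = fromRelation ContractAdj contractAdj? contractAdj-sym
    λ { _ (i≢i , _) → i≢i refl }

data ContractsTo : ∀ {m n} → ℕ → Graph m → Graph n → Set where
  done : ∀ {n} {G : Graph n} → ContractsTo 0 G G
  edge : ∀ {m n k} {G : Graph (suc m)} {G′ : Graph n} (u v : Fin (suc m)) →
         Graph._~_ G u v → ContractsTo k (contract G u v) G′ →
         ContractsTo (suc k) G G′

SemitotalDominating : ∀ {n} → Graph n → Subset n → Set
SemitotalDominating G D =
  (∀ v → v ∉ D → ∃[ w ] w ∈ D × Graph._~_ G v w) ×
  (∀ v → v ∈ D → ∃[ w ] w ∈ D × w ≢ v × DistanceAtMost G 2 v w)

Smallest : (ℕ → Set) → ℕ → Set
Smallest P k = P k × (∀ j → P j → k ≤ j)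

-- γₜ₂ and ct are partial: K₁ has no semitotal dominating set, and no sequence
-- of contractions lowers γₜ₂ below 2. They are therefore given by their graphs,
-- "γₜ₂ G k" meaning that γₜ₂(G) is defined and equal to k.
γₜ₂ : ∀ {n} → Graph n → ℕ → Set
γₜ₂ G = Smallest λ k → ∃[ D ] SemitotalDominating G D × ∣ D ∣ ≡ k

LoweredBy : ∀ {n} → Graph n → ℕ → Set
LoweredBy G k =
  ∃[ m ] Σ[ G′ ∈ Graph m ] ContractsTo k G G′ ×
    (∃[ a ] ∃[ b ] γₜ₂ G′ a × γₜ₂ G b × a < b)

ct : ∀ {n} → Graph n → ℕ → Set
ct G = Smallest (LoweredBy G)

1-EdgeContraction : ∀ {n} → Graph n → Set
1-EdgeContraction G = ∃[ k ] ct G k × k ≤ 1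

-- Structured programs for a random access machine with registers r₀, r₁, … and
-- an indirectly addressed memory. Every instruction and every test costs 1.
-- There is no multiplication, so the bit length of a value grows by at most one
-- per step (beyond the constants of the program), and unit-cost time is
-- polynomially related to Turing machine time (Cook and Reckhow 1973).
data Prog : Set where
  const     : (x c : ℕ) → Prog
  add sub   : (x y z : ℕ) → Prog
  load      : (x y : ℕ) → Prog
  store     : (x y : ℕ) → Prog
  _⨾_       : Prog → Prog → Prog
  ifNonzero : (x : ℕ) → Prog → Prog → Prog
  while     : (x : ℕ) → Prog → Prog

infixr 5 _⨾_

record State : Set where
  constructor ⟨_,_⟩
  field
    reg : ℕ → ℕ
    mem : ℕ → ℕ

open State public

_[_≔_] : (ℕ → ℕ) → ℕ → ℕ → (ℕ → ℕ)
(f [ a ≔ b ]) i = if i ≡ᵇ a then b else f i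

-- Run p s k s′: started in s, the program p halts in s′ after exactly k steps.
data Run : Prog → State → ℕ → State → Set where
  const   : ∀ {r μ x c} →
            Run (const x c) ⟨ r , μ ⟩ 1 ⟨ r [ x ≔ c ] , μ ⟩
  add     : ∀ {r μ x y z} →
            Run (add x y z) ⟨ r , μ ⟩ 1 ⟨ r [ x ≔ r y + r z ] , μ ⟩
  sub     : ∀ {r μ x y z} →
            Run (sub x y z) ⟨ r , μ ⟩ 1 ⟨ r [ x ≔ r y ∸ r z ] , μ ⟩
  load    : ∀ {r μ x y} →
            Run (load x y) ⟨ r , μ ⟩ 1 ⟨ r [ x ≔ μ (r y) ] , μ ⟩
  store   : ∀ {r μ x y} →
            Run (store x y) ⟨ r , μ ⟩ 1 ⟨ r , μ [ r x ≔ r y ] ⟩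
  seq     : ∀ {p q s s′ s″ k l} →
            Run p s k s′ → Run q s′ l s″ → Run (p ⨾ q) s (k + l) s″
  then    : ∀ {x p q s s′ k} → reg s x ≢ 0 →
            Run p s k s′ → Run (ifNonzero x p q) s (suc k) s′
  else    : ∀ {x p q s s′ k} → reg s x ≡ 0 →
            Run q s k s′ → Run (ifNonzero x p q) s (suc k) s′
  exit    : ∀ {x p s} → reg s x ≡ 0 →
            Run (while x p) s 1 s
  iterate : ∀ {x p s s′ s″ k l} → reg s x ≢ 0 →
            Run p s k s′ → Run (while x p) s′ l s″ →
            Run (while x p) s (suc (k + l)) s″

tape : List Bool → ℕ → ℕ
tape []       _       = 0
tape (b ∷ _)  zero    = if b then 1 else 0
tape (_ ∷ bs) (suc i) = tape bs i

-- The input word occupies the initial memory cells and its length is in r₀.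
initial : List Bool → State
initial w = ⟨ (λ _ → 0) [ 0 ≔ length w ] , tape w ⟩

-- 1ⁿ0 followed by the adjacency matrix, row by row.
encode : ∀ {n} → Graph n → List Bool
encode {n} G =
  replicate n true ++ false ∷ concat (tabulate λ i → tabulate λ j → Graph.adj G i j)

-- One program, with one polynomial bound in the length of the input word,
-- answers Q on all graphs of the class 𝒞: it halts with 1 in r₀ on
-- yes-instances and with 0 in r₀ on no-instances.
PolyTimeSolvableOn : (𝒞 Q : ∀ {n} → Graph n → Set) → Set
PolyTimeSolvableOn 𝒞 Q =
  ∃[ p ] ∃[ c ] ∃[ d ] (∀ {n} (G : Graph n) → 𝒞 G →
    ∃[ k ] ∃[ s ] Run p (initial (encode G)) k s ×
      k ≤ c * length (encode G) ^ d + c ×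
      ((reg s 0 ≡ 1 × Q G) ⊎ (reg s 0 ≡ 0 × ¬ Q G)))

{-# OPTIONS --safe #-}
module Submission where

-- Call D semitotal if it is a semitotal dominating set, and let K = 2(4 + t).
--
-- If G contains an induced P₅, grow it greedily to an induced P₅ + sK₁. Since
-- G is (P₅ + tK₁)-free this stops with s < t, at a dominating set of at most
-- 4 + t vertices; adding one neighbour of each gives γₜ₂(G) ≤ K. Whether
-- γₜ₂(G/uv) ≤ k < γₜ₂(G) for some edge uv and some k ≤ K is a first-order
-- sentence, and a fixed first-order sentence is checked in polynomial time by
-- nested loops over the vertices.
--
-- If γₜ₂(G) > K, then G is P₅-free, and the answer is always yes: every
-- semitotal D with at least three vertices can be changed into a semitotal set
-- of at most the same size that has an edge xy and a third vertex at distance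
-- at most two from y, so that contracting xy saves one vertex. If D has an edge
-- but no such triple, P₅-freeness allows replacing an end of the edge by the
-- next vertex on a path to the rest of D. If D is independent, two members x, y
-- have a common neighbour a, a third member z is at distance at most three from
-- {x, y}, and one or two members of D are exchanged for a and a further vertex.

open import Data.Bool using (Bool; true; false; T; if_then_else_)
open import Data.Empty using (⊥; ⊥-elim)
open import Data.Fin using (Fin; zero; suc; toℕ; fromℕ<; punchIn; punchOut; splitAt; join)
import Data.Fin as Fin
open import Data.Fin.Properties using (all?; any?; toℕ<n; toℕ-fromℕ<; toℕ-injective; ¬∀⟶∃¬)
open import Data.Fin.Properties using (punchInᵢ≢i; punchIn-injective; punchIn-punchOut; join-splitAt)
open import Data.Fin.Subset using (Subset; ∣_∣; ⁅_⁆; _∪_; ⋃) renaming (_∈_ to _∈ˢ_)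
open import Data.Fin.Subset.Properties using (∣⊥∣≡0; ∣⁅x⁆∣≡1; ∉⊥; x∈⁅x⁆; x∈⁅y⁆⇒x≡y)
open import Data.Fin.Subset.Properties using (x∈p∪q⁺; x∈p∪q⁻; drop-there) renaming (_∈?_ to _∈ˢ?_)
open import Data.List using (List; []; _∷_; _++_; _ʳ++_; length; map; filter; concat; reverse)
open import Data.List using (replicate; tabulate; allFin; upTo)
import Data.List.Membership.DecPropositional as DecMembership
open import Data.List.Membership.Propositional using (_∈_; find; lose)
open import Data.List.Membership.Propositional.Properties using (∈-map⁺; ∈-map⁻; ∈-++⁺ˡ; ∈-++⁺ʳ; ∈-++⁻)
open import Data.List.Membership.Propositional.Properties using (∈-filter⁺; ∈-filter⁻; ∈-tabulate⁺; ∈-allFin; ∈-upTo⁺)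
open import Data.List.Properties using (length-++; length-map; length-replicate; length-tabulate; length-reverse)
open import Data.List.Properties using (filter-notAll; map-∘; reverse-involutive)
open import Data.List.Relation.Unary.Any using (here; there)
import Data.List.Relation.Unary.Any as Any
open import Data.Nat using (ℕ; zero; suc; _+_; _*_; _∸_; _^_; _≤_; _<_; _≡ᵇ_; z≤n; s≤s; z<s; s≤s⁻¹; NonZero; >-nonZero)
open import Data.Nat.Properties
open import Data.Nat.Tactic.RingSolver using (solve-∀)
open import Data.Product using (∃-syntax; _×_; _,_; proj₁; proj₂)
open import Data.Sum using (_⊎_; inj₁; inj₂; [_,_]′)
open import Data.Sum.Relation.Binary.Pointwise using (Pointwise; ⊎-decidable; inj₁; inj₂)
open import Data.Unit using (⊤; tt)
open import Data.Vec using (Vec; []; _∷_; lookup)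
import Data.Vec as Vec
open import Function using (_∘_; id; _⇔_; mk⇔; Equivalence)
open import Function.Definitions using (Injective)
open import Level using (0ℓ)
open import Relation.Binary using (Rel)
open import Relation.Binary.PropositionalEquality using (_≡_; _≢_; refl; sym; trans; cong; cong₂; subst)
open import Relation.Nullary using (¬_; Dec; yes; no; ¬?; _×-dec_; _⊎-dec_; toWitness; fromWitness; decidable-stable)
open import Defs

-- Model checking on the random access machine

data Formula (k : ℕ) : Set where
  adj′ eq′   : (i j : Fin k) → Formula k
  ¬′_        : Formula k → Formula k
  _∧′_ _∨′_  : Formula k → Formula k → Formula k
  ∃′ ∀′      : Formula (suc k) → Formula k

infix  9 ¬′_
infixr 8 _∧′_
infixr 7 _∨′_

⟦_⟧ : ∀ {k n} → Formula k → Graph n → Vec (Fin n) k → Set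
⟦ adj′ i j ⟧ G ρ = Graph._~_ G (lookup ρ i) (lookup ρ j)
⟦ eq′ i j ⟧  G ρ = lookup ρ i ≡ lookup ρ j
⟦ ¬′ φ ⟧     G ρ = ¬ ⟦ φ ⟧ G ρ
⟦ φ ∧′ ψ ⟧   G ρ = ⟦ φ ⟧ G ρ × ⟦ ψ ⟧ G ρ
⟦ φ ∨′ ψ ⟧   G ρ = ⟦ φ ⟧ G ρ ⊎ ⟦ ψ ⟧ G ρ
⟦ ∃′ φ ⟧     G ρ = ∃[ v ] ⟦ φ ⟧ G (v ∷ ρ)
⟦ ∀′ φ ⟧     G ρ = ∀ v → ⟦ φ ⟧ G (v ∷ ρ)

satisfies? : ∀ {k n} (G : Graph n) (φ : Formula k) ρ → Dec (⟦ φ ⟧ G ρ)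
satisfies? G (adj′ i j) ρ = Graph._~?_ G (lookup ρ i) (lookup ρ j)
satisfies? G (eq′ i j)  ρ = lookup ρ i Fin.≟ lookup ρ j
satisfies? G (¬′ φ)     ρ = ¬? (satisfies? G φ ρ)
satisfies? G (φ ∧′ ψ)   ρ = satisfies? G φ ρ ×-dec satisfies? G ψ ρ
satisfies? G (φ ∨′ ψ)   ρ = satisfies? G φ ρ ⊎-dec satisfies? G ψ ρ
satisfies? G (∃′ φ)     ρ = any? λ v → satisfies? G φ (v ∷ ρ)
satisfies? G (∀′ φ)     ρ = all? λ v → satisfies? G φ (v ∷ ρ)

-- Register 0 holds the truth value just computed, register 1 is scratch, and
-- registers 2, 3, 4 hold n, 1, n + 1. The variable bound at depth k owns the
-- three registers from top k on: its value x, the address n + 1 + x n of row x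
-- of the adjacency matrix, and the number of values still to be tried.
top : ℕ → ℕ
top k = 5 + k * 3

slot : ∀ {k} → Fin k → ℕ
slot {suc k} zero    = top k
slot {suc k} (suc i) = slot i

negate : Prog
negate = sub 0 3 0

-- A hit clears the counter, which ends the loop with 1 still in register 0. After a miss register 0
-- holds 0, as it must when the values run out.
search : ℕ → Prog → Prog
search b p = while (2 + b)
  (p ⨾ ifNonzero 0
         (const (2 + b) 0)
         (add b b 3 ⨾ add (1 + b) (1 + b) 2 ⨾ sub (2 + b) (2 + b) 3))

-- Register b has just been cleared, so adding it copies registers 4 and 2: the address of the first
-- row and the counter n. Clearing register 0 settles the case n = 0.
exists : ℕ → Prog → Prog
exists b p = const b 0 ⨾ add (1 + b) 4 b ⨾ add (2 + b) 2 b ⨾ const 0 0 ⨾ search b p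

-- Adjacency is one memory access, at row address plus column. Equality tests that both truncated
-- differences vanish, and a universal quantifier is treated as ¬∃¬.
compile : ∀ {k} → Formula k → Prog
compile (adj′ i j)   = add 1 (1 + slot i) (slot j) ⨾ load 0 1
compile (eq′ i j)    = sub 1 (slot i) (slot j) ⨾ sub 0 (slot j) (slot i) ⨾ add 0 0 1 ⨾ negate
compile (¬′ φ)       = compile φ ⨾ negate
compile (φ ∧′ ψ)     = compile φ ⨾ ifNonzero 0 (compile ψ) (const 0 0)
compile (φ ∨′ ψ)     = compile φ ⨾ ifNonzero 0 (const 0 1) (compile ψ)
compile {k} (∃′ φ)   = exists (top k) (compile φ)
compile {k} (∀′ φ)   = exists (top k) (compile φ ⨾ negate) ⨾ negate

-- Each round of a search costs 5 more than its body: the loop test, the branch and three updates.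
-- The other 5 are four initial assignments and the last loop test.
cost : ∀ {k} → Formula k → ℕ → ℕ
cost (adj′ i j) n = 2
cost (eq′ i j)  n = 4
cost (¬′ φ)     n = cost φ n + 1
cost (φ ∧′ ψ)   n = cost φ n + (cost ψ n + 2)
cost (φ ∨′ ψ)   n = cost φ n + (cost ψ n + 2)
cost (∃′ φ)     n = n * (cost φ n + 5) + 5
cost (∀′ φ)     n = n * (cost φ n + 1 + 5) + 5 + 1

-- Register updates, frames and assignments

upd-same : ∀ (f : ℕ → ℕ) a {b} → (f [ a ≔ b ]) a ≡ b
upd-same f a with a ≡ᵇ a | ≡⇒≡ᵇ a a refl
... | true | _ = refl

upd-other : ∀ (f : ℕ → ℕ) {a b i} → i ≢ a → (f [ a ≔ b ]) i ≡ f i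
upd-other f {a} {b} {i} i≢a with i ≡ᵇ a | ≡ᵇ⇒≡ i a
... | true  | e = ⊥-elim (i≢a (e tt))
... | false | _ = refl

Verdict : ℕ → Set → Set
Verdict x P = (x ≡ 1 × P) ⊎ (x ≡ 0 × ¬ P)

verdict-negate : ∀ {x y P} → y ≡ 1 → Verdict x P → Verdict (y ∸ x) (¬ P)
verdict-negate refl (inj₁ (refl , p))  = inj₂ (refl , λ ¬p → ¬p p)
verdict-negate refl (inj₂ (refl , ¬p)) = inj₁ (refl , ¬p)

-- Only the constants and the slots of variables already bound must survive a subprogram; the
-- scratch registers 0 and 1 and all deeper slots may change.
Frame : ℕ → (r r′ : ℕ → ℕ) → Set
Frame b r r′ = ∀ i → 2 ≤ i → i < b → r′ i ≡ r i

frame-trans : ∀ {b r r′ r″} → Frame b r r′ → Frame b r′ r″ → Frame b r r″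
frame-trans f g i 2≤i i<b = trans (g i 2≤i i<b) (f i 2≤i i<b)

frame-weaken : ∀ {b b′ r r′} → b ≤ b′ → Frame b′ r r′ → Frame b r r′
frame-weaken b≤b′ f i 2≤i i<b = f i 2≤i (<-≤-trans i<b b≤b′)

frame-low : ∀ {b r x y} → x < 2 → Frame b r (r [ x ≔ y ])
frame-low {r = r} x<2 i 2≤i _ = upd-other r λ { refl → <⇒≱ x<2 2≤i }

frame-high : ∀ {b r x y} → b ≤ x → Frame b r (r [ x ≔ y ])
frame-high {r = r} b≤x i _ i<b = upd-other r λ { refl → <⇒≱ i<b b≤x }

-- The countdown register of a variable is left out: formulas read only the value and the row
-- address, and the frame condition protects the counter.
Holds : ∀ {n k} → Vec (Fin n) k → (ℕ → ℕ) → Set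
Holds {n} {zero}  []      r = r 2 ≡ n × r 3 ≡ 1 × r 4 ≡ suc n
Holds {n} {suc k} (v ∷ ρ) r =
  r (top k) ≡ toℕ v × r (suc (top k)) ≡ suc n + toℕ v * n × Holds ρ r

top-mono : ∀ k → top k ≤ top (suc k)
top-mono k = m≤n+m (top k) 3

holds-frame : ∀ {n k r r′} (ρ : Vec (Fin n) k) → Frame (top k) r r′ → Holds ρ r → Holds ρ r′
holds-frame [] f (p , q , s) =
  trans (f 2 (s≤s (s≤s z≤n)) (s≤s (s≤s (s≤s z≤n)))) p ,
  trans (f 3 (s≤s (s≤s z≤n)) (s≤s (s≤s (s≤s (s≤s z≤n))))) q ,
  trans (f 4 (s≤s (s≤s z≤n)) (s≤s (s≤s (s≤s (s≤s (s≤s z≤n)))))) s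
holds-frame {k = suc k} (v ∷ ρ) f (p , q , h) =
  trans (f (top k) (s≤s (s≤s z≤n)) (m≤n+m _ 2)) p ,
  trans (f (suc (top k)) (s≤s (s≤s z≤n)) (m≤n+m _ 1)) q ,
  holds-frame ρ (frame-weaken (top-mono k) f) h

holds-consts : ∀ {n k r} (ρ : Vec (Fin n) k) → Holds ρ r → r 2 ≡ n × r 3 ≡ 1 × r 4 ≡ suc n
holds-consts []      h           = h
holds-consts (_ ∷ ρ) (_ , _ , h) = holds-consts ρ h

holds-slot : ∀ {n k r} (ρ : Vec (Fin n) k) i → Holds ρ r →
  r (slot i) ≡ toℕ (lookup ρ i) × r (suc (slot i)) ≡ suc n + toℕ (lookup ρ i) * n
holds-slot (_ ∷ ρ) zero    (p , q , _) = p , q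
holds-slot (_ ∷ ρ) (suc i) (_ , _ , h) = holds-slot ρ i h

-- The input word in memory

tape-++ˡ : ∀ xs ys {i} → i < length xs → tape (xs ++ ys) i ≡ tape xs i
tape-++ˡ (x ∷ xs) ys {zero}  _         = refl
tape-++ˡ (x ∷ xs) ys {suc i} (s≤s i<k) = tape-++ˡ xs ys i<k

tape-++ʳ : ∀ xs ys i → tape (xs ++ ys) (length xs + i) ≡ tape ys i
tape-++ʳ []       ys i = refl
tape-++ʳ (x ∷ xs) ys i = tape-++ʳ xs ys i

tape-tabulate : ∀ {n} (f : Fin n → Bool) j → tape (tabulate f) (toℕ j) ≡ (if f j then 1 else 0)
tape-tabulate f zero    = refl
tape-tabulate f (suc j) = tape-tabulate (f ∘ suc) j

tape-matrix : ∀ {m n} (f : Fin m → Fin n → Bool) i j →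
  tape (concat (tabulate λ i → tabulate (f i))) (toℕ i * n + toℕ j) ≡ (if f i j then 1 else 0)
tape-matrix f zero j =
  trans (tape-++ˡ (tabulate (f zero)) _ (subst (toℕ j <_) (sym (length-tabulate (f zero))) (toℕ<n j)))
        (tape-tabulate (f zero) j)
tape-matrix {n = n} f (suc i) j =
  trans (cong (tape (tabulate (f zero) ++ rest))
          (trans (+-assoc n (toℕ i * n) (toℕ j))
                 (cong (_+ (toℕ i * n + toℕ j)) (sym (length-tabulate (f zero))))))
  (trans (tape-++ʳ (tabulate (f zero)) rest (toℕ i * n + toℕ j))
         (tape-matrix (f ∘ suc) i j))
  where
  rest : List Bool
  rest = concat (tabulate λ i → tabulate (f (suc i)))

rows : ∀ {n} → Graph n → List Bool
rows G = concat (tabulate λ i → tabulate (Graph.adj G i))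

tape-encode : ∀ {n} (G : Graph n) i j →
  tape (encode G) (suc n + toℕ i * n + toℕ j) ≡ (if Graph.adj G i j then 1 else 0)
tape-encode {n} G i j =
  trans (cong (tape (encode G))
          (trans (lem n (toℕ i * n) (toℕ j))
                 (cong (_+ suc (toℕ i * n + toℕ j)) (sym (length-replicate n {true})))))
  (trans (tape-++ʳ (replicate n true) (false ∷ rows G) (suc (toℕ i * n + toℕ j)))
         (tape-matrix (Graph.adj G) i j))
  where
  lem : ∀ n a b → suc n + a + b ≡ n + suc (a + b)
  lem = solve-∀

tape-ones : ∀ n ys {i} → i < n → tape (replicate n true ++ ys) i ≡ 1
tape-ones (suc n) ys {zero}  _         = refl
tape-ones (suc n) ys {suc i} (s≤s i<n) = tape-ones n ys i<n

tape-end : ∀ n ys → tape (replicate n true ++ false ∷ ys) n ≡ 0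
tape-end zero    ys = refl
tape-end (suc n) ys = tape-end n ys

length-encode : ∀ {n} (G : Graph n) → suc n ≤ length (encode G)
length-encode {n} G = subst (suc n ≤_) (sym size) (m≤m+n (suc n) (length (rows G)))
  where
  size : length (encode G) ≡ suc n + length (rows G)
  size = trans (length-++ (replicate n true))
         (trans (cong (_+ suc (length (rows G))) (length-replicate n)) (+-suc n _))

-- Correctness and running time of compiled formulas

module _ {n : ℕ} (G : Graph n) where

  private
    μ : ℕ → ℕ
    μ = tape (encode G)

  -- Compiled formulas never store, so the memory is the input word before and after. The time bound
  -- c is uniform in the assignment.
  Computes : ℕ → Prog → (k : ℕ) → (Vec (Fin n) k → Set) → Set
  Computes c p k P = ∀ ρ r → Holds ρ r →
    ∃[ s ] ∃[ r′ ] Run p ⟨ r , μ ⟩ s ⟨ r′ , μ ⟩ × s ≤ c × Frame (top k) r r′ × Verdict (r′ 0) (P ρ)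

  computes-negate : ∀ {c p k P} → Computes c p k P → Computes (c + 1) (p ⨾ negate) k (λ ρ → ¬ P ρ)
  computes-negate C ρ r h with C ρ r h
  ... | s , r′ , run , s≤c , f , v =
    s + 1 , _ , seq run sub , +-monoˡ-≤ 1 s≤c , frame-trans f (frame-low z<s) ,
    verdict-negate (proj₁ (proj₂ (holds-consts ρ (holds-frame ρ f h)))) v

  module _ {c p k} {P : Vec (Fin n) (suc k) → Set} (C : Computes c p (suc k) P) where

    private
      b : ℕ
      b = top k

      b≢1+b : b ≢ 1 + b
      b≢1+b = <⇒≢ (n<1+n b)

      b≢2+b : b ≢ 2 + b
      b≢2+b = <⇒≢ (m≤n+m _ 1)

      1+b≢2+b : 1 + b ≢ 2 + b
      1+b≢2+b = <⇒≢ (n<1+n (1 + b))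

    -- Loop invariant, by induction on the number m of values left: the registers describe the
    -- candidate j, and no value below j satisfies P.
    run-search : ∀ (ρ : Vec (Fin n) k) m j r → Holds ρ r → r 0 ≡ 0 → j + m ≡ n →
      r b ≡ j → r (1 + b) ≡ suc n + j * n → r (2 + b) ≡ m →
      (∀ v → toℕ v < j → ¬ P (v ∷ ρ)) →
      ∃[ s ] ∃[ r′ ] Run (search b p) ⟨ r , μ ⟩ s ⟨ r′ , μ ⟩ × s ≤ m * (c + 5) + 1 ×
        Frame b r r′ × Verdict (r′ 0) (∃[ v ] P (v ∷ ρ))
    run-search ρ zero j r h r0 jm _ _ cnt none =
      1 , r , exit cnt , ≤-refl , (λ _ _ _ → refl) , inj₂ (r0 , λ (v , pv) →
        none v (subst (toℕ v <_) (trans (sym jm) (+-identityʳ j)) (toℕ<n v)) pv)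
    run-search ρ (suc m) j r h r0 jm val row cnt none
      -- The body runs at depth `suc k`. Its frame reaches up to `top k + 3`, so all three registers
      -- of this loop survive it.
      with C (v ∷ ρ) r (trans val (sym v≡j) , trans row (cong (λ x → suc n + x * n) (sym v≡j)) , h)
      where
      j<n : j < n
      j<n = subst (j <_) jm (m<m+n j z<s)
      v : Fin n
      v = fromℕ< j<n
      v≡j : toℕ v ≡ j
      v≡j = toℕ-fromℕ< j<n
    ... | s , r₁ , run , s≤c , f , inj₁ (e , pv) =
      _ , r₁ [ 2 + b ≔ 0 ] ,
      iterate (λ e → 0≢1+n (trans (sym e) cnt)) (seq run (then (λ e′ → 0≢1+n (trans (sym e′) e)) const))
        (exit (upd-same r₁ (2 + b))) ,
      bound , frame-trans (frame-weaken (top-mono k) f) (frame-high (m≤n+m b 2)) , inj₁ (e , _ , pv)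
      where
      bound : suc (s + 2 + 1) ≤ suc m * (c + 5) + 1
      bound = ≤-trans (subst (_≤ c + 5) (lem s) (+-mono-≤ s≤c (n≤1+n 4)))
                (≤-trans (m≤m+n (c + 5) (m * (c + 5))) (m≤m+n _ 1))
        where
        lem : ∀ s → s + 4 ≡ suc (s + 2 + 1)
        lem = solve-∀
    ... | s , r₁ , run , s≤c , f , inj₂ (e , ¬pv)
      with run-search ρ m (suc j) r₄ (holds-frame ρ fr h) e (trans (sym (+-suc j m)) jm) val′ row′ cnt′ none′
      where
      r₂ = r₁ [ b ≔ r₁ b + r₁ 3 ]
      r₃ = r₂ [ 1 + b ≔ r₂ (1 + b) + r₂ 2 ]
      r₄ = r₃ [ 2 + b ≔ r₃ (2 + b) ∸ r₃ 3 ]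
      f′ : Frame b r r₁
      f′ = frame-weaken (top-mono k) f
      fr : Frame b r r₄
      fr = frame-trans f′ (frame-trans (frame-high ≤-refl)
             (frame-trans (frame-high (m≤n+m b 1)) (frame-high (m≤n+m b 2))))
      consts : r₁ 2 ≡ n × r₁ 3 ≡ 1 × r₁ 4 ≡ suc n
      consts = holds-consts ρ (holds-frame ρ f′ h)
      val′ : r₄ b ≡ suc j
      val′ = trans (upd-other r₃ b≢2+b) (trans (upd-other r₂ b≢1+b) (trans (upd-same r₁ b)
        (trans (cong₂ _+_ (trans (f b (s≤s (s≤s z≤n)) (m≤n+m _ 2)) val) (proj₁ (proj₂ consts)))
               (+-comm j 1))))
      row′ : r₄ (1 + b) ≡ suc n + suc j * n
      row′ = trans (upd-other r₃ 1+b≢2+b) (trans (upd-same r₂ (1 + b))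
        (trans (cong₂ _+_ (trans (upd-other r₁ (b≢1+b ∘ sym)) (trans (f (1 + b) (s≤s (s≤s z≤n)) (m≤n+m _ 1)) row))
                          (proj₁ consts))
               (lem n (j * n))))
        where
        lem : ∀ n x → suc n + x + n ≡ suc n + (n + x)
        lem = solve-∀
      cnt′ : r₄ (2 + b) ≡ m
      cnt′ = trans (upd-same r₃ (2 + b))
        (cong₂ _∸_ (trans (upd-other r₂ (1+b≢2+b ∘ sym)) (trans (upd-other r₁ (b≢2+b ∘ sym))
                     (trans (f (2 + b) (s≤s (s≤s z≤n)) ≤-refl) cnt)))
                   (proj₁ (proj₂ consts)))
      none′ : ∀ v → toℕ v < suc j → ¬ P (v ∷ ρ)
      none′ v (s≤s v≤j) pv with m≤n⇒m<n∨m≡n v≤j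
      ... | inj₁ v<j  = none v v<j pv
      ... | inj₂ refl = ¬pv (subst (λ u → P (u ∷ ρ)) (toℕ-injective (sym (toℕ-fromℕ< _))) pv)
    ... | l , r′ , run′ , l≤ , g , w =
      _ , r′ ,
      iterate (λ e′ → 0≢1+n (trans (sym e′) cnt)) (seq run (else e (seq add (seq add sub)))) run′ ,
      bound ,
      frame-trans (frame-weaken (top-mono k) f)
        (frame-trans (frame-high ≤-refl) (frame-trans (frame-high (m≤n+m b 1))
          (frame-trans (frame-high (m≤n+m b 2)) g))) ,
      w
      where
      bound : suc (s + 4 + l) ≤ suc m * (c + 5) + 1
      bound = regroup (+-mono-≤ (+-monoˡ-≤ 5 s≤c) l≤)
        where
        lem : ∀ s l → s + 5 + l ≡ suc (s + 4 + l)
        lem = solve-∀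
        regroup : s + 5 + l ≤ c + 5 + (m * (c + 5) + 1) → suc (s + 4 + l) ≤ suc m * (c + 5) + 1
        regroup x rewrite lem s l | +-assoc (c + 5) (m * (c + 5)) 1 = x

    computes-exists : Computes (n * (c + 5) + 5) (exists b p) k (λ ρ → ∃[ v ] P (v ∷ ρ))
    computes-exists ρ r h
      with run-search ρ n 0 r₄ (holds-frame ρ fr h) refl refl val row cnt (λ _ ())
      where
      r₁ = r [ b ≔ 0 ]
      r₂ = r₁ [ 1 + b ≔ r₁ 4 + r₁ b ]
      r₃ = r₂ [ 2 + b ≔ r₂ 2 + r₂ b ]
      r₄ = r₃ [ 0 ≔ 0 ]
      fr : Frame b r r₄
      fr = frame-trans (frame-high ≤-refl) (frame-trans (frame-high (m≤n+m b 1))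
             (frame-trans (frame-high (m≤n+m b 2)) (frame-low z<s)))
      consts : r 2 ≡ n × r 3 ≡ 1 × r 4 ≡ suc n
      consts = holds-consts ρ h
      val : r₄ b ≡ 0
      val = trans (upd-other r₂ b≢2+b) (trans (upd-other r₁ b≢1+b) (upd-same r b))
      row : r₄ (1 + b) ≡ suc n + 0
      row = trans (upd-other r₂ 1+b≢2+b) (trans (upd-same r₁ (1 + b))
              (cong₂ _+_ (proj₂ (proj₂ consts)) (upd-same r b)))
      cnt : r₄ (2 + b) ≡ n
      cnt = trans (upd-same r₂ (2 + b))
              (trans (cong₂ _+_ (proj₁ consts) (trans (upd-other r₁ b≢1+b) (upd-same r b))) (+-identityʳ n))
    ... | s , r′ , run , s≤ , f , w =
      _ , r′ , seq const (seq add (seq add (seq const run))) , bound ,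
      frame-trans (frame-high ≤-refl) (frame-trans (frame-high (m≤n+m b 1))
        (frame-trans (frame-high (m≤n+m b 2)) (frame-trans (frame-low z<s) f))) ,
      w
      where
      bound : 4 + s ≤ n * (c + 5) + 5
      bound = subst (4 + s ≤_) (lem (n * (c + 5))) (+-monoʳ-≤ 4 s≤)
        where
        lem : ∀ x → 4 + (x + 1) ≡ x + 5
        lem = solve-∀

  bool-verdict : ∀ {x} b → x ≡ (if b then 1 else 0) → Verdict x (T b)
  bool-verdict true  e = inj₁ (e , tt)
  bool-verdict false e = inj₂ (e , λ ())

  distance-verdict : ∀ (u v : Fin n) → Verdict (1 ∸ ((toℕ v ∸ toℕ u) + (toℕ u ∸ toℕ v))) (u ≡ v)
  distance-verdict u v with toℕ v ∸ toℕ u in p | toℕ u ∸ toℕ v in q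
  ... | zero  | zero  = inj₁ (refl , toℕ-injective (≤-antisym (m∸n≡0⇒m≤n q) (m∸n≡0⇒m≤n p)))
  ... | zero  | suc y = inj₂ (0∸n≡0 y , λ { refl → 0≢1+n (trans (sym (n∸n≡0 (toℕ u))) q) })
  ... | suc x | y     = inj₂ (0∸n≡0 (x + y) , λ { refl → 0≢1+n (trans (sym (n∸n≡0 (toℕ u))) p) })

  computes : ∀ {k} (φ : Formula k) → Computes (cost φ n) (compile φ) k (⟦ φ ⟧ G)
  computes (adj′ i j) ρ r h =
    2 , _ , seq add load , ≤-refl , frame-trans (frame-low (s≤s (s≤s z≤n))) (frame-low z<s) ,
    bool-verdict _ (trans (cong μ (cong₂ _+_ (proj₂ (holds-slot ρ i h)) (proj₁ (holds-slot ρ j h))))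
                          (tape-encode G (lookup ρ i) (lookup ρ j)))
  computes (eq′ i j) ρ r h =
    4 , _ , seq sub (seq sub (seq add sub)) , ≤-refl ,
    frame-trans (frame-low (s≤s (s≤s z≤n))) (frame-trans (frame-low z<s)
      (frame-trans (frame-low z<s) (frame-low z<s))) ,
    subst (λ x → Verdict x (lookup ρ i ≡ lookup ρ j)) (sym val) (distance-verdict (lookup ρ i) (lookup ρ j))
    where
    slot≢1 : ∀ {k} (i : Fin k) → slot i ≢ 1
    slot≢1 {suc k} zero    ()
    slot≢1 {suc k} (suc i) = slot≢1 i
    r₁ = r [ 1 ≔ r (slot i) ∸ r (slot j) ]
    at : ∀ i → r₁ (slot i) ≡ toℕ (lookup ρ i)
    at i = trans (upd-other r (slot≢1 i)) (proj₁ (holds-slot ρ i h))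
    val : r 3 ∸ ((r₁ (slot j) ∸ r₁ (slot i)) + (r (slot i) ∸ r (slot j))) ≡
          1 ∸ ((toℕ (lookup ρ j) ∸ toℕ (lookup ρ i)) + (toℕ (lookup ρ i) ∸ toℕ (lookup ρ j)))
    val = cong₂ _∸_ (proj₁ (proj₂ (holds-consts ρ h)))
            (cong₂ _+_ (cong₂ _∸_ (at j) (at i))
              (cong₂ _∸_ (proj₁ (holds-slot ρ i h)) (proj₁ (holds-slot ρ j h))))
  computes (¬′ φ) = computes-negate (computes φ)
  computes (φ ∧′ ψ) ρ r h with computes φ ρ r h
  ... | s , r₁ , run , s≤ , f , inj₂ (e , ¬p) =
    _ , _ , seq run (else e const) , +-mono-≤ s≤ (m≤n+m 2 _) , frame-trans f (frame-low z<s) ,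
    inj₂ (refl , ¬p ∘ proj₁)
  ... | s , r₁ , run , s≤ , f , inj₁ (e , p) with computes ψ ρ r₁ (holds-frame ρ f h)
  ... | s′ , r₂ , run′ , s′≤ , g , v =
    _ , _ , seq run (then (λ e′ → 0≢1+n (trans (sym e′) e)) run′) ,
    +-mono-≤ s≤ (subst (_≤ cost ψ n + 2) (+-comm s′ 1) (+-mono-≤ s′≤ (n≤1+n 1))) , frame-trans f g , both v
    where
    both : ∀ {x} → Verdict x (⟦ ψ ⟧ G ρ) → Verdict x (⟦ φ ∧′ ψ ⟧ G ρ)
    both (inj₁ (e , q))  = inj₁ (e , p , q)
    both (inj₂ (e , ¬q)) = inj₂ (e , ¬q ∘ proj₂)
  computes (φ ∨′ ψ) ρ r h with computes φ ρ r h
  ... | s , r₁ , run , s≤ , f , inj₁ (e , p) =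
    _ , _ , seq run (then (λ e′ → 0≢1+n (trans (sym e′) e)) const) , +-mono-≤ s≤ (m≤n+m 2 _) ,
    frame-trans f (frame-low z<s) , inj₁ (refl , inj₁ p)
  ... | s , r₁ , run , s≤ , f , inj₂ (e , ¬p) with computes ψ ρ r₁ (holds-frame ρ f h)
  ... | s′ , r₂ , run′ , s′≤ , g , v =
    _ , _ , seq run (else e run′) ,
    +-mono-≤ s≤ (subst (_≤ cost ψ n + 2) (+-comm s′ 1) (+-mono-≤ s′≤ (n≤1+n 1))) , frame-trans f g , either v
    where
    either : ∀ {x} → Verdict x (⟦ ψ ⟧ G ρ) → Verdict x (⟦ φ ∨′ ψ ⟧ G ρ)
    either (inj₁ (e , q))  = inj₁ (e , inj₂ q)
    either (inj₂ (e , ¬q)) = inj₂ (e , λ { (inj₁ p) → ¬p p ; (inj₂ q) → ¬q q })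
  computes (∃′ φ) = computes-exists (computes φ)
  -- What has been computed is ¬∃¬; since satisfaction is decidable, this is ∀.
  computes (∀′ φ) ρ r h with computes-negate (computes-exists (computes-negate (computes φ))) ρ r h
  ... | s , r′ , run , s≤ , f , inj₁ (e , ¬∃¬) =
    s , r′ , run , s≤ , f , inj₁ (e , λ v → decidable-stable (satisfies? G φ (v ∷ ρ)) (¬∃¬ ∘ (v ,_)))
  ... | s , r′ , run , s≤ , f , inj₂ (e , ¬¬∃¬) =
    s , r′ , run , s≤ , f , inj₂ (e , λ all → ¬¬∃¬ λ (v , ¬p) → ¬p (all v))

-- The decision program and its polynomial bound

scan : Prog
scan = while 1 (add 2 2 3 ⨾ load 1 2)

-- Register 2 walks along the unary prefix of the input and stops at the 0 that ends it, where its
-- value is n.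
setup : Prog
setup = const 3 1 ⨾ load 1 2 ⨾ scan ⨾ add 4 2 3

decider : Formula 0 → Prog
decider φ = setup ⨾ compile φ

-- Read off the formula alone. Under connectives the degrees add up, which majorises both operands
-- at once; a quantifier contributes one more factor.
coefficient degree : ∀ {k} → Formula k → ℕ
coefficient (adj′ i j) = 2
coefficient (eq′ i j)  = 4
coefficient (¬′ φ)     = coefficient φ + 1
coefficient (φ ∧′ ψ)   = coefficient φ + (coefficient ψ + 2)
coefficient (φ ∨′ ψ)   = coefficient φ + (coefficient ψ + 2)
coefficient (∃′ φ)     = coefficient φ + 5 + 5
coefficient (∀′ φ)     = coefficient φ + 1 + 5 + 5 + 1
degree (adj′ i j) = 0
degree (eq′ i j)  = 0
degree (¬′ φ)     = degree φ
degree (φ ∧′ ψ)   = degree φ + degree ψ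
degree (φ ∨′ ψ)   = degree φ + degree ψ
degree (∃′ φ)     = suc (degree φ)
degree (∀′ φ)     = suc (degree φ)

module _ {L : ℕ} .{{_ : NonZero L}} where

  -- Since L is positive, `L ^ d` is at least 1 and absorbs additive constants.
  +const-bound : ∀ {x} c d a → x ≤ c * L ^ d → x + a ≤ (c + a) * L ^ d
  +const-bound {x} c d a le = subst (x + a ≤_) (sym (*-distribʳ-+ (L ^ d) c a))
    (+-mono-≤ le (m≤m*n a (L ^ d) {{m^n≢0 L d}}))

  sum-bound : ∀ {x y} c c′ d d′ → x ≤ c * L ^ d → y ≤ c′ * L ^ d′ → x + y ≤ (c + c′) * L ^ (d + d′)
  sum-bound {x} {y} c c′ d d′ p q = subst (x + y ≤_) (sym (*-distribʳ-+ (L ^ (d + d′)) c c′))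
    (+-mono-≤ (≤-trans p (*-monoʳ-≤ c (^-monoʳ-≤ L (m≤m+n d d′))))
              (≤-trans q (*-monoʳ-≤ c′ (^-monoʳ-≤ L (m≤n+m d′ d)))))

  loop-bound : ∀ {n x} c d → n ≤ L → x ≤ c * L ^ d → n * x ≤ c * L ^ suc d
  loop-bound {n} {x} c d n≤L le = subst (n * x ≤_) (lem L c (L ^ d)) (*-mono-≤ n≤L le)
    where
    lem : ∀ L c p → L * (c * p) ≡ c * (L * p)
    lem = solve-∀

  cost-bound : ∀ {k n} (φ : Formula k) → n ≤ L → cost φ n ≤ coefficient φ * L ^ degree φ
  cost-bound (adj′ i j) _ = ≤-refl
  cost-bound (eq′ i j)  _ = ≤-refl
  cost-bound (¬′ φ)   n≤L = +const-bound (coefficient φ) (degree φ) 1 (cost-bound φ n≤L)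
  cost-bound (φ ∧′ ψ) n≤L = sum-bound (coefficient φ) (coefficient ψ + 2) (degree φ) (degree ψ)
    (cost-bound φ n≤L) (+const-bound (coefficient ψ) (degree ψ) 2 (cost-bound ψ n≤L))
  cost-bound (φ ∨′ ψ) n≤L = sum-bound (coefficient φ) (coefficient ψ + 2) (degree φ) (degree ψ)
    (cost-bound φ n≤L) (+const-bound (coefficient ψ) (degree ψ) 2 (cost-bound ψ n≤L))
  cost-bound (∃′ φ)   n≤L = +const-bound (c + 5) (suc d) 5 (loop-bound (c + 5) d n≤L
    (+const-bound c d 5 (cost-bound φ n≤L)))
    where
    c = coefficient φ
    d = degree φ
  cost-bound (∀′ φ)   n≤L = +const-bound (c + 1 + 5 + 5) (suc d) 1 (+const-bound (c + 1 + 5) (suc d) 5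
    (loop-bound (c + 1 + 5) d n≤L (+const-bound (c + 1) d 5 (+const-bound c d 1 (cost-bound φ n≤L)))))
    where
    c = coefficient φ
    d = degree φ

module _ {n : ℕ} (G : Graph n) where

  private
    μ : ℕ → ℕ
    μ = tape (encode G)

  run-scan : ∀ m j r → j + m ≡ n → r 1 ≡ μ j → r 2 ≡ j → r 3 ≡ 1 →
    ∃[ r′ ] Run scan ⟨ r , μ ⟩ (m * 3 + 1) ⟨ r′ , μ ⟩ × r′ 2 ≡ n × r′ 3 ≡ 1
  run-scan zero j r jm flag idx one with trans (sym (+-identityʳ j)) jm
  ... | refl = r , exit (trans flag (tape-end n _)) , idx , one
  run-scan (suc m) j r jm flag idx one =
    let r′ , run , res = run-scan m (suc j) _ (trans (sym (+-suc j m)) jm) (cong μ next) next one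
    in r′ , iterate (λ e → 0≢1+n (trans (sym e) (trans flag (tape-ones n _ (subst (j <_) jm (m<m+n j z<s))))))
              (seq add load) run , res
    where
    next : r 2 + r 3 ≡ suc j
    next = trans (cong₂ _+_ idx one) (+-comm j 1)

  run-setup : ∃[ r ] Run setup (initial (encode G)) (1 + (1 + (n * 3 + 1 + 1))) ⟨ r , μ ⟩ × Holds {n} [] r
  run-setup =
    let r , run , two , three = run-scan n 0 _ refl refl refl refl
    in _ , seq const (seq load (seq run add)) , two , three , trans (cong₂ _+_ two three) (+-comm n 1)

-- The sentence is fixed before the graph is given, so one program, coefficient and exponent serve
-- all instances.
polyTime : ∀ {𝒞 Q : ∀ {n} → Graph n → Set} (φ : Formula 0) →
  (∀ {n} (G : Graph n) → 𝒞 G → (⟦ φ ⟧ G [] → Q G) × (Q G → ⟦ φ ⟧ G [])) →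
  PolyTimeSolvableOn 𝒞 Q
polyTime {𝒞} {Q} φ spec = decider φ , 7 + coefficient φ , 1 + degree φ , solves
  where
  solves : ∀ {n} (G : Graph n) → 𝒞 G → ∃[ k ] ∃[ s ] Run (decider φ) (initial (encode G)) k s ×
      k ≤ (7 + coefficient φ) * length (encode G) ^ (1 + degree φ) + (7 + coefficient φ) ×
      ((reg s 0 ≡ 1 × Q G) ⊎ (reg s 0 ≡ 0 × ¬ Q G))
  solves {n} G inC with run-setup G
  ... | r , run , h with computes G φ [] r h
  ... | s , r′ , run′ , s≤ , _ , v = _ , _ , seq run run′ , m≤n⇒m≤n+o _ bound , answer v
    where
    L = length (encode G)
    instance
      L≢0 : NonZero L
      L≢0 = >-nonZero (≤-trans (s≤s z≤n) (length-encode G))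
    n≤L : n ≤ L
    n≤L = ≤-trans (n≤1+n n) (length-encode G)
    -- The setup takes 3n + 4 steps, and both n and 1 are at most L.
    prologue : 1 + (1 + (n * 3 + 1 + 1)) ≤ 7 * L ^ 1
    prologue = subst (_≤ 7 * L ^ 1) (lem n)
      (+const-bound 3 1 4 (subst (n * 3 ≤_) (cong (3 *_) (sym (*-identityʳ L)))
        (subst (n * 3 ≤_) (*-comm L 3) (*-monoˡ-≤ 3 n≤L))))
      where
      lem : ∀ n → n * 3 + 4 ≡ 1 + (1 + (n * 3 + 1 + 1))
      lem = solve-∀
    bound : 1 + (1 + (n * 3 + 1 + 1)) + s ≤ (7 + coefficient φ) * L ^ (1 + degree φ)
    bound = sum-bound 7 (coefficient φ) 1 (degree φ) prologue (≤-trans s≤ (cost-bound φ n≤L))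
    answer : Verdict (r′ 0) (⟦ φ ⟧ G []) → Verdict (r′ 0) (Q G)
    answer (inj₁ (e , p))  = inj₁ (e , proj₁ (spec G inC) p)
    answer (inj₂ (e , ¬p)) = inj₂ (e , ¬p ∘ proj₂ (spec G inC))

-- Semitotal dominating sets as lists

-- merge u v stands for G / uv with the vertex set V(G) ∖ {v}, as in contract.
data Minor (A : Set) : Set where
  whole : Minor A
  merge : (u v : A) → Minor A

mapᵐ : ∀ {A B} → (A → B) → Minor A → Minor B
mapᵐ f whole       = whole
mapᵐ f (merge u v) = merge (f u) (f v)

Skipped : ∀ {n} → Minor (Fin n) → Fin n → Set
Skipped whole       _ = ⊥
Skipped (merge _ v) x = x ≡ v

Adjacent : ∀ {n} → Graph n → Minor (Fin n) → Rel (Fin n) 0ℓ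
Adjacent G whole       x y = Graph._~_ G x y
Adjacent G (merge u v) x y =
  x ≢ v × y ≢ v × x ≢ y × (x ~ y ⊎ (x ≡ u × v ~ y) ⊎ (y ≡ u × v ~ x))
  where open Graph G

-- A walk of length one or two; between distinct vertices this is distance at most two.
Near : ∀ {n} → Rel (Fin n) 0ℓ → Rel (Fin n) 0ℓ
Near R x y = R x y ⊎ ∃[ c ] R x c × R c y

-- Lists may repeat vertices. This is harmless, as lengths enter only as upper bounds on sizes.
STD : ∀ {n} → Graph n → Minor (Fin n) → List (Fin n) → Set
STD G m l =
  (∀ x → Skipped m x ⊎ x ∈ l ⊎ ∃[ w ] w ∈ l × Adjacent G m x w) ×
  (∀ x → x ∈ l → ∃[ w ] w ∈ l × w ≢ x × Near (Adjacent G m) x w)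

HasSTD : ∀ {n} → Graph n → Minor (Fin n) → ℕ → Set
HasSTD G m k = ∃[ l ] length l ≤ k × STD G m l

-- First-order formulas for semitotal domination

⊥′ : ∀ {k} → Formula k
⊥′ = ∃′ (¬′ eq′ zero zero)

⋁ : ∀ {k} {A : Set} → List A → (A → Formula k) → Formula k
⋁ []       f = ⊥′
⋁ (x ∷ xs) f = f x ∨′ ⋁ xs f

skippedF : ∀ {k} → Minor (Fin k) → Fin k → Formula k
skippedF whole       x = ⊥′
skippedF (merge _ v) x = eq′ x v

adjacentF : ∀ {k} → Minor (Fin k) → (x y : Fin k) → Formula k
adjacentF whole       x y = adj′ x y
adjacentF (merge u v) x y =
  ¬′ eq′ x v ∧′ ¬′ eq′ y v ∧′ ¬′ eq′ x y ∧′ (adj′ x y ∨′ (eq′ x u ∧′ adj′ v y) ∨′ (eq′ y u ∧′ adj′ v x))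

memberF : ∀ {k} → List (Fin k) → Fin k → Formula k
memberF xs x = ⋁ xs (eq′ x)

nearF : ∀ {k} → Minor (Fin k) → (x y : Fin k) → Formula k
nearF m x y = adjacentF m x y ∨′
  ∃′ (adjacentF (mapᵐ suc m) (suc x) zero ∧′ adjacentF (mapᵐ suc m) zero (suc y))

stdF : ∀ {k} → Minor (Fin k) → List (Fin k) → Formula k
stdF m xs = ∀′ (
  (skippedF m′ zero ∨′ memberF xs′ zero ∨′ ⋁ xs′ (adjacentF m′ zero)) ∧′
  (¬′ memberF xs′ zero ∨′ ⋁ xs′ (λ w → ¬′ eq′ w zero ∧′ nearF m′ zero w)))
  where
  m′  = mapᵐ suc m
  xs′ = map suc xs

-- The variables in `xs` are the members chosen so far, and at most j more are quantified. For each
-- fixed j this is one first-order formula.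
hasSTDF : ∀ {k} → ℕ → Minor (Fin k) → List (Fin k) → Formula k
hasSTDF zero    m xs = stdF m xs
hasSTDF (suc j) m xs = stdF m xs ∨′ ∃′ (hasSTDF j (mapᵐ suc m) (zero ∷ map suc xs))

module _ {n} (G : Graph n) where

  open DecMembership {A = Fin n} Fin._≟_ using (_∈?_)

  ⋁-sound : ∀ {k} {A : Set} {f : A → Formula k} {ρ} xs → ⟦ ⋁ xs f ⟧ G ρ → ∃[ x ] x ∈ xs × ⟦ f x ⟧ G ρ
  ⋁-sound []       (_ , v≢v) = ⊥-elim (v≢v refl)
  ⋁-sound (x ∷ xs) (inj₁ p)  = x , here refl , p
  ⋁-sound (x ∷ xs) (inj₂ q)  = let y , y∈ , p = ⋁-sound xs q in y , there y∈ , p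

  ⋁-complete : ∀ {k} {A : Set} {f : A → Formula k} {ρ x xs} → x ∈ xs → ⟦ f x ⟧ G ρ → ⟦ ⋁ xs f ⟧ G ρ
  ⋁-complete (here refl) p = inj₁ p
  ⋁-complete (there x∈)  p = inj₂ (⋁-complete x∈ p)

  module _ {k} (ρ : Vec (Fin n) k) where

    private
      ⟪_⟫ : Fin k → Fin n
      ⟪ i ⟫ = lookup ρ i

    ⋁-map-sound : ∀ {f : Fin k → Formula k} {P : Fin n → Set} xs → (∀ i → ⟦ f i ⟧ G ρ → P ⟪ i ⟫) →
      ⟦ ⋁ xs f ⟧ G ρ → ∃[ w ] w ∈ map ⟪_⟫ xs × P w
    ⋁-map-sound xs f⇒P p = let i , i∈ , q = ⋁-sound xs p in ⟪ i ⟫ , ∈-map⁺ ⟪_⟫ i∈ , f⇒P i q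

    ⋁-map-complete : ∀ {f : Fin k → Formula k} {P : Fin n → Set} xs → (∀ i → P ⟪ i ⟫ → ⟦ f i ⟧ G ρ) →
      ∃[ w ] w ∈ map ⟪_⟫ xs × P w → ⟦ ⋁ xs f ⟧ G ρ
    ⋁-map-complete xs P⇒f (w , w∈ , p) with ∈-map⁻ ⟪_⟫ w∈
    ... | i , i∈ , refl = ⋁-complete i∈ (P⇒f i p)

    skippedF-sem : ∀ m x → (⟦ skippedF m x ⟧ G ρ → Skipped (mapᵐ ⟪_⟫ m) ⟪ x ⟫) ×
                           (Skipped (mapᵐ ⟪_⟫ m) ⟪ x ⟫ → ⟦ skippedF m x ⟧ G ρ)
    skippedF-sem whole       x = (λ (_ , v≢v) → v≢v refl) , λ ()
    skippedF-sem (merge _ _) x = id , id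

    adjacentF-sem : ∀ m x y → ⟦ adjacentF m x y ⟧ G ρ ≡ Adjacent G (mapᵐ ⟪_⟫ m) ⟪ x ⟫ ⟪ y ⟫
    adjacentF-sem whole       x y = refl
    adjacentF-sem (merge _ _) x y = refl

    mapᵐ-suc : ∀ (m : Minor (Fin k)) {v} → mapᵐ (lookup (v ∷ ρ)) (mapᵐ suc m) ≡ mapᵐ ⟪_⟫ m
    mapᵐ-suc whole       = refl
    mapᵐ-suc (merge _ _) = refl

    map-suc : ∀ (xs : List (Fin k)) {v} → map (lookup (v ∷ ρ)) (map suc xs) ≡ map ⟪_⟫ xs
    map-suc xs = sym (map-∘ xs)

  nearF-sem : ∀ {k} (ρ : Vec (Fin n) k) m x y →
    ⟦ nearF m x y ⟧ G ρ ≡ Near (Adjacent G (mapᵐ (lookup ρ) m)) (lookup ρ x) (lookup ρ y)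
  nearF-sem ρ whole       x y = refl
  nearF-sem ρ (merge _ _) x y = refl

  memberF-sem : ∀ {k} (ρ : Vec (Fin n) k) xs x → (⟦ memberF xs x ⟧ G ρ → lookup ρ x ∈ map (lookup ρ) xs) ×
    (lookup ρ x ∈ map (lookup ρ) xs → ⟦ memberF xs x ⟧ G ρ)
  memberF-sem ρ xs x =
    (λ p → let _ , w∈ , e = ⋁-map-sound ρ {P = lookup ρ x ≡_} xs (λ _ → id) p in subst (_∈ _) (sym e) w∈) ,
    (λ x∈ → ⋁-map-complete ρ {P = lookup ρ x ≡_} xs (λ _ → id) (_ , x∈ , refl))

  module _ {k} (ρ : Vec (Fin n) k) (m : Minor (Fin k)) (xs : List (Fin k)) where

    private
      m′ : Minor (Fin (suc k))
      m′ = mapᵐ suc m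

      xs′ : List (Fin (suc k))
      xs′ = map suc xs

      -- The two conditions of `STD` at one vertex. List and minor are arguments so that the
      -- weakening by the bound variable can be rewritten away.
      Dominated Attended : List (Fin n) → Minor (Fin n) → Fin n → Set
      Dominated l μ x = Skipped μ x ⊎ x ∈ l ⊎ ∃[ w ] w ∈ l × Adjacent G μ x w
      Attended  l μ x = x ∈ l → ∃[ w ] w ∈ l × w ≢ x × Near (Adjacent G μ) x w

    dominated-sem : ∀ x → let ρ′ = x ∷ ρ in
      (⟦ skippedF m′ zero ∨′ memberF xs′ zero ∨′ ⋁ xs′ (adjacentF m′ zero) ⟧ G ρ′ →
        Dominated (map (lookup ρ′) xs′) (mapᵐ (lookup ρ′) m′) x) ×
      (Dominated (map (lookup ρ′) xs′) (mapᵐ (lookup ρ′) m′) x →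
        ⟦ skippedF m′ zero ∨′ memberF xs′ zero ∨′ ⋁ xs′ (adjacentF m′ zero) ⟧ G ρ′)
    dominated-sem x = to , from
      where
      ρ′ = x ∷ ρ
      to : _ → _
      to (inj₁ p)        = inj₁ (proj₁ (skippedF-sem ρ′ m′ zero) p)
      to (inj₂ (inj₁ p)) = inj₂ (inj₁ (proj₁ (memberF-sem ρ′ xs′ zero) p))
      to (inj₂ (inj₂ p)) = inj₂ (inj₂ (⋁-map-sound ρ′ xs′ (λ i → subst id (adjacentF-sem ρ′ m′ zero i)) p))
      from : _ → _
      from (inj₁ p)        = inj₁ (proj₂ (skippedF-sem ρ′ m′ zero) p)
      from (inj₂ (inj₁ p)) = inj₂ (inj₁ (proj₂ (memberF-sem ρ′ xs′ zero) p))
      from (inj₂ (inj₂ p)) = inj₂ (inj₂ (⋁-map-complete ρ′ xs′ (λ i → subst id (sym (adjacentF-sem ρ′ m′ zero i))) p))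

    attended-sem : ∀ x → let ρ′ = x ∷ ρ in
      (⟦ ¬′ memberF xs′ zero ∨′ ⋁ xs′ (λ w → ¬′ eq′ w zero ∧′ nearF m′ zero w) ⟧ G ρ′ →
        Attended (map (lookup ρ′) xs′) (mapᵐ (lookup ρ′) m′) x) ×
      (Attended (map (lookup ρ′) xs′) (mapᵐ (lookup ρ′) m′) x →
        ⟦ ¬′ memberF xs′ zero ∨′ ⋁ xs′ (λ w → ¬′ eq′ w zero ∧′ nearF m′ zero w) ⟧ G ρ′)
    attended-sem x = to , from
      where
      ρ′ = x ∷ ρ
      to : _ → _
      to (inj₁ x∉) x∈ = ⊥-elim (x∉ (proj₂ (memberF-sem ρ′ xs′ zero) x∈))
      to (inj₂ p)  _  = ⋁-map-sound ρ′ xs′ (λ i (i≢ , near) → i≢ , subst id (nearF-sem ρ′ m′ zero i) near) p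
      from : _ → _
      from att with x ∈? map (lookup ρ′) xs′
      ... | no  x∉ = inj₁ (x∉ ∘ proj₁ (memberF-sem ρ′ xs′ zero))
      ... | yes x∈ = inj₂ (⋁-map-complete ρ′ xs′
        (λ i (i≢ , near) → i≢ , subst id (sym (nearF-sem ρ′ m′ zero i)) near) (att x∈))

    stdF-sem : (⟦ stdF m xs ⟧ G ρ → STD G (mapᵐ (lookup ρ) m) (map (lookup ρ) xs)) ×
               (STD G (mapᵐ (lookup ρ) m) (map (lookup ρ) xs) → ⟦ stdF m xs ⟧ G ρ)
    stdF-sem =
      (λ h → (λ x → shift Dominated (proj₁ (dominated-sem x) (proj₁ (h x)))) ,
             (λ x → shift Attended (proj₁ (attended-sem x) (proj₂ (h x))))) ,
      (λ (dom , att) x → proj₂ (dominated-sem x) (unshift Dominated (dom x)) ,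
                         proj₂ (attended-sem x) (unshift Attended (att x)))
      where
      shift : ∀ (P : List (Fin n) → Minor (Fin n) → Fin n → Set) {x} →
        P (map (lookup (x ∷ ρ)) xs′) (mapᵐ (lookup (x ∷ ρ)) m′) x → P (map (lookup ρ) xs) (mapᵐ (lookup ρ) m) x
      shift P {x} rewrite map-suc ρ xs {x} | mapᵐ-suc ρ m {x} = id
      unshift : ∀ (P : List (Fin n) → Minor (Fin n) → Fin n → Set) {x} →
        P (map (lookup ρ) xs) (mapᵐ (lookup ρ) m) x → P (map (lookup (x ∷ ρ)) xs′) (mapᵐ (lookup (x ∷ ρ)) m′) x
      unshift P {x} rewrite map-suc ρ xs {x} | mapᵐ-suc ρ m {x} = id

  -- Each quantifier pushes its vertex onto the list of members, so the new vertices end up reversed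
  -- in front of the old ones; hence `ʳ++`.
  hasSTDF-sound : ∀ {k} j (ρ : Vec (Fin n) k) m xs → ⟦ hasSTDF j m xs ⟧ G ρ →
    ∃[ l ] length l ≤ j × STD G (mapᵐ (lookup ρ) m) (l ʳ++ map (lookup ρ) xs)
  hasSTDF-sound zero    ρ m xs h        = [] , z≤n , proj₁ (stdF-sem ρ m xs) h
  hasSTDF-sound (suc j) ρ m xs (inj₁ h) = [] , z≤n , proj₁ (stdF-sem ρ m xs) h
  hasSTDF-sound (suc j) ρ m xs (inj₂ (v , h)) with hasSTDF-sound j (v ∷ ρ) (mapᵐ suc m) (zero ∷ map suc xs) h
  ... | l , l≤ , std rewrite map-suc ρ xs {v} | mapᵐ-suc ρ m {v} = v ∷ l , s≤s l≤ , std

  hasSTDF-complete : ∀ {k} j (ρ : Vec (Fin n) k) m xs l → length l ≤ j →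
    STD G (mapᵐ (lookup ρ) m) (l ʳ++ map (lookup ρ) xs) → ⟦ hasSTDF j m xs ⟧ G ρ
  hasSTDF-complete zero    ρ m xs []      _        std = proj₂ (stdF-sem ρ m xs) std
  hasSTDF-complete (suc j) ρ m xs []      _        std = inj₁ (proj₂ (stdF-sem ρ m xs) std)
  hasSTDF-complete (suc j) ρ m xs (v ∷ l) (s≤s l≤) std =
    inj₂ (v , hasSTDF-complete j (v ∷ ρ) (mapᵐ suc m) (zero ∷ map suc xs) l l≤ std′)
    where
    std′ : STD G (mapᵐ (lookup (v ∷ ρ)) (mapᵐ suc m)) (l ʳ++ (v ∷ map (lookup (v ∷ ρ)) (map suc xs)))
    std′ rewrite map-suc ρ xs {v} | mapᵐ-suc ρ m {v} = std

  hasSTDF-sem : ∀ {k} j (ρ : Vec (Fin n) k) m →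
    (⟦ hasSTDF j m [] ⟧ G ρ → HasSTD G (mapᵐ (lookup ρ) m) j) ×
    (HasSTD G (mapᵐ (lookup ρ) m) j → ⟦ hasSTDF j m [] ⟧ G ρ)
  hasSTDF-sem j ρ m =
    (λ h → let l , l≤ , std = hasSTDF-sound j ρ m [] h in
      reverse l , subst (_≤ j) (sym (length-reverse l)) l≤ , std) ,
    (λ (l , l≤ , std) → hasSTDF-complete j ρ m [] (reverse l) (subst (_≤ j) (sym (length-reverse l)) l≤)
      (subst (STD G _) (sym (reverse-involutive l)) std))

  -- Satisfaction of formulas in a finite graph is decidable, so this comes from the formula.
  hasSTD? : ∀ j → Dec (HasSTD G whole j)
  hasSTD? j with satisfies? G (hasSTDF j whole []) []
  ... | yes p = yes (proj₁ (hasSTDF-sem j [] whole) p)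
  ... | no ¬p = no (¬p ∘ proj₂ (hasSTDF-sem j [] whole))

-- Translation between lists and subsets

elements : ∀ {n} → Subset n → List (Fin n)
elements []          = []
elements (true ∷ D)  = zero ∷ map suc (elements D)
elements (false ∷ D) = map suc (elements D)

length-elements : ∀ {n} (D : Subset n) → length (elements D) ≡ ∣ D ∣
length-elements []          = refl
length-elements (true ∷ D)  = cong suc (trans (length-map suc (elements D)) (length-elements D))
length-elements (false ∷ D) = trans (length-map suc (elements D)) (length-elements D)

elements⁺ : ∀ {n} {D : Subset n} {x} → x ∈ˢ D → x ∈ elements D
elements⁺ {D = true ∷ D}  {zero}  _  = here refl
elements⁺ {D = true ∷ D}  {suc x} x∈ = there (∈-map⁺ suc (elements⁺ (drop-there x∈)))
elements⁺ {D = false ∷ D} {suc x} x∈ = ∈-map⁺ suc (elements⁺ (drop-there x∈))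

elements⁻ : ∀ {n} {D : Subset n} {x} → x ∈ elements D → x ∈ˢ D
elements⁻ {D = true ∷ D}  (here refl) = Vec.here
elements⁻ {D = true ∷ D}  (there x∈) with ∈-map⁻ suc x∈
... | _ , y∈ , refl = Vec.there (elements⁻ y∈)
elements⁻ {D = false ∷ D} x∈ with ∈-map⁻ suc x∈
... | _ , y∈ , refl = Vec.there (elements⁻ y∈)

∣p∪q∣≤∣p∣+∣q∣ : ∀ {n} (p q : Subset n) → ∣ p ∪ q ∣ ≤ ∣ p ∣ + ∣ q ∣
∣p∪q∣≤∣p∣+∣q∣ []          []          = z≤n
∣p∪q∣≤∣p∣+∣q∣ (true ∷ p)  (true ∷ q)  = s≤s (≤-trans (∣p∪q∣≤∣p∣+∣q∣ p q) (+-monoʳ-≤ ∣ p ∣ (n≤1+n ∣ q ∣)))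
∣p∪q∣≤∣p∣+∣q∣ (true ∷ p)  (false ∷ q) = s≤s (∣p∪q∣≤∣p∣+∣q∣ p q)
∣p∪q∣≤∣p∣+∣q∣ (false ∷ p) (true ∷ q)  = subst (suc ∣ p ∪ q ∣ ≤_) (sym (+-suc ∣ p ∣ ∣ q ∣)) (s≤s (∣p∪q∣≤∣p∣+∣q∣ p q))
∣p∪q∣≤∣p∣+∣q∣ (false ∷ p) (false ∷ q) = ∣p∪q∣≤∣p∣+∣q∣ p q

fromList : ∀ {n} → List (Fin n) → Subset n
fromList l = ⋃ (map ⁅_⁆ l)

∣fromList∣ : ∀ {n} (l : List (Fin n)) → ∣ fromList l ∣ ≤ length l
∣fromList∣ {n} []  = ≤-reflexive (∣⊥∣≡0 n)
∣fromList∣ (x ∷ l) = ≤-trans (∣p∪q∣≤∣p∣+∣q∣ ⁅ x ⁆ (fromList l))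
  (subst (λ a → a + ∣ fromList l ∣ ≤ suc (length l)) (sym (∣⁅x⁆∣≡1 x)) (s≤s (∣fromList∣ l)))

fromList⁺ : ∀ {n} {l : List (Fin n)} {x} → x ∈ l → x ∈ˢ fromList l
fromList⁺ {x = x} (here refl) = x∈p∪q⁺ (inj₁ (x∈⁅x⁆ x))
fromList⁺         (there x∈)  = x∈p∪q⁺ (inj₂ (fromList⁺ x∈))

fromList⁻ : ∀ {n} {l : List (Fin n)} {x} → x ∈ˢ fromList l → x ∈ l
fromList⁻ {l = []}    x∈ = ⊥-elim (∉⊥ x∈)
fromList⁻ {l = y ∷ l} x∈ with x∈p∪q⁻ ⁅ y ⁆ (fromList l) x∈
... | inj₁ x∈y = here (x∈⁅y⁆⇒x≡y y x∈y)
... | inj₂ x∈l = there (fromList⁻ x∈l)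

module _ {n} (G : Graph n) where

  open Graph G

  near⇒distance : ∀ {x y} → Near _~_ x y → DistanceAtMost G 2 x y
  near⇒distance (inj₁ p)           = 1 , s≤s z≤n , step p stop
  near⇒distance (inj₂ (_ , p , q)) = 2 , ≤-refl , step p (step q stop)

  distance⇒near : ∀ {x y} → y ≢ x → DistanceAtMost G 2 x y → Near _~_ x y
  distance⇒near y≢x (_ , _ , stop)                 = ⊥-elim (y≢x refl)
  distance⇒near _   (_ , _ , step p stop)          = inj₁ p
  distance⇒near _   (_ , _ , step p (step q stop)) = inj₂ (_ , p , q)
  distance⇒near _   (_ , s≤s (s≤s ()) , step _ (step _ (step _ _)))

  fromSubset : ∀ {D} → SemitotalDominating G D → HasSTD G whole ∣ D ∣
  fromSubset {D} (dom , att) = elements D , ≤-reflexive (length-elements D) , dom′ ,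
    λ x x∈ → let w , w∈ , w≢x , d = att x (elements⁻ x∈) in w , elements⁺ w∈ , w≢x , distance⇒near w≢x d
    where
    dom′ : ∀ x → ⊥ ⊎ x ∈ elements D ⊎ ∃[ w ] w ∈ elements D × x ~ w
    dom′ x with x ∈ˢ? D
    ... | yes x∈ = inj₂ (inj₁ (elements⁺ x∈))
    ... | no  x∉ = let w , w∈ , x~w = dom x x∉ in inj₂ (inj₂ (w , elements⁺ w∈ , x~w))

  toSubset : ∀ {k} → HasSTD G whole k → ∃[ D ] SemitotalDominating G D × ∣ D ∣ ≤ k
  toSubset (l , l≤ , dom , att) = fromList l , (dom′ , att′) , ≤-trans (∣fromList∣ l) l≤
    where
    dom′ : ∀ x → ¬ (x ∈ˢ fromList l) → ∃[ w ] w ∈ˢ fromList l × x ~ w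
    dom′ x x∉ with dom x
    ... | inj₂ (inj₁ x∈)             = ⊥-elim (x∉ (fromList⁺ x∈))
    ... | inj₂ (inj₂ (w , w∈ , x~w)) = w , fromList⁺ w∈ , x~w
    att′ : ∀ x → x ∈ˢ fromList l → ∃[ w ] w ∈ˢ fromList l × w ≢ x × DistanceAtMost G 2 x w
    att′ x x∈ = let w , w∈ , w≢x , nr = att x (fromList⁻ x∈) in w , fromList⁺ w∈ , w≢x , near⇒distance nr

  -- Neither direction of the translation increases the size, so the minima agree.
  γ⇒smallest : ∀ {a} → γₜ₂ G a → Smallest (HasSTD G whole) a
  γ⇒smallest {a} ((D , std , refl) , least) = fromSubset std , λ j h →
    let D′ , std′ , D′≤j = toSubset h in ≤-trans (least _ (D′ , std′ , refl)) D′≤j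

  smallest⇒γ : ∀ {a} → Smallest (HasSTD G whole) a → γₜ₂ G a
  smallest⇒γ {a} (h , least) =
    let D , std , D≤a = toSubset h in
    (D , std , ≤-antisym D≤a (least _ (fromSubset std))) ,
    λ { _ (_ , std′ , refl) → least _ (fromSubset std′) }

smallest : ∀ {P : ℕ → Set} → (∀ k → Dec (P k)) → ∀ k → P k → ∃[ a ] Smallest P a
smallest {P} P? k p with P? 0
... | yes p₀ = 0 , p₀ , λ _ _ → z≤n
smallest {P} P? zero    p | no ¬p₀ = ⊥-elim (¬p₀ p)
smallest {P} P? (suc k) p | no ¬p₀ =
  let a , pa , least = smallest (P? ∘ suc) k p in
  suc a , pa , λ { zero p₀ → ⊥-elim (¬p₀ p₀) ; (suc j) pj → s≤s (least j pj) }

-- Contraction of a single edge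

module _ {n} (G : Graph (suc n)) (u v : Fin (suc n)) where

  private
    H = contract G u v
    ι : Fin n → Fin (suc n)
    ι = punchIn v

  contract⇒adjacent : ∀ {i j} → Graph._~_ H i j → Adjacent G (merge u v) (ι i) (ι j)
  contract⇒adjacent {i} {j} p with toWitness {a? = contractAdj? G u v i j} p
  ... | i≢j , q = punchInᵢ≢i v i , punchInᵢ≢i v j , i≢j ∘ punchIn-injective v i j , q

  adjacent⇒contract : ∀ {i j} → Adjacent G (merge u v) (ι i) (ι j) → Graph._~_ H i j
  adjacent⇒contract {i} {j} (_ , _ , ιi≢ιj , q) =
    fromWitness {a? = contractAdj? G u v i j} (ιi≢ιj ∘ cong ι , q)

  unpunch : ∀ {x} → x ≢ v → ∃[ i ] ι i ≡ x
  unpunch {x} x≢v = punchOut (x≢v ∘ sym) , punchIn-punchOut (x≢v ∘ sym)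

  unpunch-list : ∀ l → (∀ x → x ∈ l → x ≢ v) → ∃[ l′ ] map ι l′ ≡ l
  unpunch-list []      _ = [] , refl
  unpunch-list (x ∷ l) h with unpunch (h x (here refl)) | unpunch-list l (λ y → h y ∘ there)
  ... | i , refl | l′ , refl = i ∷ l′ , refl

  contract⇒merge : ∀ {k} → HasSTD H whole k → HasSTD G (merge u v) k
  contract⇒merge {k} (l , l≤ , dom , att) = map ι l , subst (_≤ k) (sym (length-map ι l)) l≤ , dom′ , att′
    where
    dom′ : ∀ x → x ≡ v ⊎ x ∈ map ι l ⊎ ∃[ w ] w ∈ map ι l × Adjacent G (merge u v) x w
    dom′ x with x Fin.≟ v
    ... | yes x≡v = inj₁ x≡v
    ... | no  x≢v with unpunch x≢v
    ... | i , refl with dom i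
    ... | inj₂ (inj₁ i∈)           = inj₂ (inj₁ (∈-map⁺ ι i∈))
    ... | inj₂ (inj₂ (w , w∈ , a)) = inj₂ (inj₂ (ι w , ∈-map⁺ ι w∈ , contract⇒adjacent a))
    near : ∀ {i j} → Near (Graph._~_ H) i j → Near (Adjacent G (merge u v)) (ι i) (ι j)
    near (inj₁ a)           = inj₁ (contract⇒adjacent a)
    near (inj₂ (c , a , b)) = inj₂ (ι c , contract⇒adjacent a , contract⇒adjacent b)
    att′ : ∀ x → x ∈ map ι l → ∃[ w ] w ∈ map ι l × w ≢ x × Near (Adjacent G (merge u v)) x w
    att′ x x∈ with ∈-map⁻ ι x∈
    ... | i , i∈ , refl = let w , w∈ , w≢i , nr = att i i∈ in
      ι w , ∈-map⁺ ι w∈ , w≢i ∘ punchIn-injective v w i , near nr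

  merge⇒contract : ∀ {k} → HasSTD G (merge u v) k → HasSTD H whole k
  merge⇒contract {k} (l , l≤ , dom , att) with unpunch-list l avoids
    where
    -- Every member is attended, hence has a neighbour in the minor, which v has not.
    avoids : ∀ x → x ∈ l → x ≢ v
    avoids x x∈ with att x x∈
    ... | _ , _ , _ , inj₁ (x≢v , _)           = x≢v
    ... | _ , _ , _ , inj₂ (_ , (x≢v , _) , _) = x≢v
  ... | l′ , refl = l′ , subst (_≤ k) (length-map ι l′) l≤ , dom′ , att′
    where
    member : ∀ {i} → ι i ∈ map ι l′ → i ∈ l′
    member {i} i∈ with ∈-map⁻ ι i∈
    ... | j , j∈ , e = subst (_∈ l′) (sym (punchIn-injective v i j e)) j∈
    dom′ : ∀ i → ⊥ ⊎ i ∈ l′ ⊎ ∃[ w ] w ∈ l′ × Graph._~_ H i w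
    dom′ i with dom (ι i)
    ... | inj₁ e                   = ⊥-elim (punchInᵢ≢i v i e)
    ... | inj₂ (inj₁ i∈)           = inj₂ (inj₁ (member i∈))
    ... | inj₂ (inj₂ (w , w∈ , a)) with ∈-map⁻ ι w∈
    ... | j , j∈ , refl = inj₂ (inj₂ (j , j∈ , adjacent⇒contract a))
    near : ∀ {i j} → Near (Adjacent G (merge u v)) (ι i) (ι j) → Near (Graph._~_ H) i j
    near (inj₁ a) = inj₁ (adjacent⇒contract a)
    near (inj₂ (c , a@(_ , c≢v , _) , b)) with unpunch c≢v
    ... | i , refl = inj₂ (i , adjacent⇒contract a , adjacent⇒contract b)
    att′ : ∀ i → i ∈ l′ → ∃[ w ] w ∈ l′ × w ≢ i × Near (Graph._~_ H) i w
    att′ i i∈ with att (ι i) (∈-map⁺ ι i∈)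
    ... | w , w∈ , w≢ , nr with ∈-map⁻ ι w∈
    ... | j , j∈ , refl = j , j∈ , w≢ ∘ cong ι , near nr

¬loweredBy₀ : ∀ {n} {G : Graph n} → ¬ LoweredBy G 0
¬loweredBy₀ (_ , _ , done , a , b , (pa , _) , (_ , b-least) , a<b) = <⇒≱ a<b (b-least a pa)

-- The threshold k = γₜ₂(G/uv) separates the two graphs. Unlike a comparison of minima, a threshold
-- is directly expressible by formulas.
1-EdgeContraction⇒lowered : ∀ {n} {G : Graph n} → 1-EdgeContraction G →
  ∃[ u ] ∃[ v ] Graph._~_ G u v × ∃[ k ] HasSTD G (merge u v) k × ¬ HasSTD G whole k
1-EdgeContraction⇒lowered (0 , (low , _) , _) = ⊥-elim (¬loweredBy₀ low)
1-EdgeContraction⇒lowered (suc (suc _) , _ , s≤s ())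
1-EdgeContraction⇒lowered {G = G} (1 , ((_ , _ , edge u v u~v done , a , b , γa , γb , a<b) , _) , _) =
  u , v , u~v , a , contract⇒merge G u v (proj₁ (γ⇒smallest _ γa)) ,
  λ h → <⇒≱ a<b (proj₂ (γ⇒smallest G γb) a h)

-- Here γₜ₂(G/uv) ≤ k < γₜ₂(G); the set of size at most j makes γₜ₂(G) defined.
lowered⇒1-EdgeContraction : ∀ {n} {G : Graph n} {u v k j} → Graph._~_ G u v →
  HasSTD G (merge u v) k → ¬ HasSTD G whole k → HasSTD G whole j → 1-EdgeContraction G
lowered⇒1-EdgeContraction {suc n} {G} {u} {v} {k} {j} u~v h ¬h hj =
  1 , ((_ , _ , edge u v u~v done , a , b , smallest⇒γ _ sa , smallest⇒γ G sb , a<b) ,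
       λ { zero low → ⊥-elim (¬loweredBy₀ low) ; (suc _) _ → s≤s z≤n }) , ≤-refl
  where
  hk : HasSTD (contract G u v) whole k
  hk = merge⇒contract G u v h
  least-contract = smallest (hasSTD? (contract G u v)) k hk
  least-whole    = smallest (hasSTD? G) j hj
  a = proj₁ least-contract
  b = proj₁ least-whole
  sa = proj₂ least-contract
  sb = proj₂ least-whole
  a<b : a < b
  a<b = ≤-<-trans (proj₂ sa k hk) (≰⇒> λ b≤k → let l , l≤ , std = proj₁ sb in ¬h (l , ≤-trans l≤ b≤k , std))

-- Exchange arguments in P₅-free graphs

module _ {n} (G : Graph n) where

  open Graph G

  remove : Fin n → List (Fin n) → List (Fin n)
  remove x = filter λ w → ¬? (w Fin.≟ x)

  ∈-remove⁺ : ∀ {x w l} → w ∈ l → w ≢ x → w ∈ remove x l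
  ∈-remove⁺ = ∈-filter⁺ _

  ∈-remove⁻ : ∀ {x w} l → w ∈ remove x l → w ∈ l × w ≢ x
  ∈-remove⁻ l = ∈-filter⁻ _ {xs = l}

  length-remove : ∀ {x l} → x ∈ l → length (remove x l) < length l
  length-remove {l = l} x∈ = filter-notAll _ l (Any.map (λ { refl ¬refl → ¬refl refl }) x∈)

  ~-distinct : ∀ {x y} → x ~ y → x ≢ y
  ~-distinct x~x refl = irreflexive _ x~x

  near? : ∀ x y → Dec (Near _~_ x y)
  near? x y = (x ~? y) ⊎-dec any? λ c → (x ~? c) ×-dec (c ~? y)

  near-sym : ∀ {x y} → Near _~_ x y → Near _~_ y x
  near-sym (inj₁ p)           = inj₁ (symmetric p)
  near-sym (inj₂ (c , p , q)) = inj₂ (c , symmetric q , symmetric p)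

  -- Contracting an edge between two members

  module _ {x y} (x~y : x ~ y) where

    private
      infix 4 _~ᶜ_
      _~ᶜ_ : Fin n → Fin n → Set
      _~ᶜ_ = Adjacent G (merge x y)

    -- The quotient map onto G/xy.
    collapse : Fin n → Fin n
    collapse w with w Fin.≟ y
    ... | yes _ = x
    ... | no  _ = w

    collapse-fix : ∀ {w} → w ≢ y → collapse w ≡ w
    collapse-fix {w} w≢y with w Fin.≟ y
    ... | yes w≡y = ⊥-elim (w≢y w≡y)
    ... | no  _   = refl

    collapse-merged : collapse y ≡ x
    collapse-merged with y Fin.≟ y
    ... | yes _   = refl
    ... | no  y≢y = ⊥-elim (y≢y refl)

    collapse-step : ∀ {a b} → a ~ b → collapse a ≢ collapse b → collapse a ~ᶜ collapse b
    collapse-step {a} {b} a~b a≢b with a Fin.≟ y | b Fin.≟ y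
    ... | yes refl | yes refl = ⊥-elim (a≢b refl)
    ... | yes refl | no b≢y   = ~-distinct x~y , b≢y , a≢b , inj₂ (inj₁ (refl , a~b))
    ... | no a≢y   | yes refl = a≢y , ~-distinct x~y , a≢b , inj₂ (inj₂ (refl , symmetric a~b))
    ... | no a≢y   | no b≢y   = a≢y , b≢y , a≢b , inj₁ a~b

    -- A step along xy disappears and every other step survives, so walks do not become longer.
    collapse-near : ∀ {a b} → Near _~_ a b → collapse a ≢ collapse b → Near _~ᶜ_ (collapse a) (collapse b)
    collapse-near (inj₁ p) a≢b = inj₁ (collapse-step p a≢b)
    collapse-near {a} {b} (inj₂ (c , p , q)) a≢b with collapse a Fin.≟ collapse c | collapse c Fin.≟ collapse b
    ... | yes a≡c | _       = inj₁ (subst (_~ᶜ collapse b) (sym a≡c) (collapse-step q λ e → a≢b (subst (_≡ collapse b) (sym a≡c) e)))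
    ... | no  a≢c | yes c≡b = inj₁ (subst (collapse a ~ᶜ_) c≡b (collapse-step p a≢c))
    ... | no  a≢c | no c≢b  = inj₂ (collapse c , collapse-step p a≢c , collapse-step q c≢b)

    -- If the partner of x was y, then z takes over after the contraction of xy.
    friendly-triple : ∀ {k z l} → length l ≤ suc k → STD G whole l → x ∈ l → y ∈ l → z ∈ l →
      z ≢ x → z ≢ y → Near _~_ y z → HasSTD G (merge x y) k
    friendly-triple {k} {z} {l} l≤ (dom , att) x∈ y∈ z∈ z≢x z≢y y≈z =
      remove y l , s≤s⁻¹ (≤-trans (length-remove y∈) l≤) , dom′ , att′
      where
      x∈′ : x ∈ remove y l
      x∈′ = ∈-remove⁺ x∈ (~-distinct x~y)
      collapse∈ : ∀ {w} → w ∈ l → collapse w ∈ remove y l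
      collapse∈ {w} w∈ with w Fin.≟ y
      ... | yes _  = x∈′
      ... | no w≢y = ∈-remove⁺ w∈ w≢y
      dom′ : ∀ w → w ≡ y ⊎ w ∈ remove y l ⊎ ∃[ d ] d ∈ remove y l × w ~ᶜ d
      dom′ w with w Fin.≟ y
      ... | yes w≡y = inj₁ w≡y
      ... | no  w≢y with dom w
      ... | inj₂ (inj₁ w∈) = inj₂ (inj₁ (∈-remove⁺ w∈ w≢y))
      ... | inj₂ (inj₂ (d , d∈ , w~d)) with w Fin.≟ collapse d
      ... | yes refl = inj₂ (inj₁ (collapse∈ d∈))
      ... | no  w≢d  = inj₂ (inj₂ (collapse d , collapse∈ d∈ ,
        subst (_~ᶜ collapse d) (collapse-fix w≢y) (collapse-step w~d (w≢d ∘ subst (_≡ collapse d) (collapse-fix w≢y)))))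
      att′ : ∀ w → w ∈ remove y l → ∃[ d ] d ∈ remove y l × d ≢ w × Near _~ᶜ_ w d
      att′ w w∈′ with ∈-remove⁻ l w∈′
      ... | w∈ , w≢y with att w w∈
      ... | d , d∈ , d≢w , w≈d with collapse d Fin.≟ w
      ... | no  d≢w′ = collapse d , collapse∈ d∈ , d≢w′ ,
        subst (λ v → Near _~ᶜ_ v (collapse d)) (collapse-fix w≢y)
          (collapse-near w≈d (d≢w′ ∘ sym ∘ subst (_≡ collapse d) (collapse-fix w≢y)))
      ... | yes d≡w with d Fin.≟ y
      ... | no  _    = ⊥-elim (d≢w d≡w)
      ... | yes refl = z , ∈-remove⁺ z∈ z≢y , (λ e → z≢x (subst (z ≡_) (sym d≡w) e)) ,
        subst (λ v → Near _~ᶜ_ v z) d≡w (near-x (collapse-near y≈z))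
        where
        near-x : (collapse y ≢ collapse z → Near _~ᶜ_ (collapse y) (collapse z)) → Near _~ᶜ_ x z
        near-x h rewrite collapse-merged | collapse-fix z≢y = h (z≢x ∘ sym)

  -- The set l′ arises from l by deleting vertices with the property R and adding
  -- vertices that are attended in l′.
  exchange : ∀ {l l′} (R : Fin n → Set) → STD G whole l →
    (∀ {w} → w ∈ l → w ∈ l′ ⊎ R w) →
    (∀ {r q} → R r → q ≡ r ⊎ q ~ r → q ∈ l′ ⊎ ∃[ d ] d ∈ l′ × q ~ d) →
    (∀ {r w} → R r → w ∈ l → w ∈ l′ → Near _~_ w r → ∃[ d ] d ∈ l′ × d ≢ w × Near _~_ w d) →
    (∀ {w} → w ∈ l′ → w ∈ l ⊎ ∃[ d ] d ∈ l′ × d ≢ w × Near _~_ w d) →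
    STD G whole l′
  exchange {l} {l′} R (dom , att) keep dominate attend new = dom′ , att′
    where
    dom′ : ∀ q → ⊥ ⊎ q ∈ l′ ⊎ ∃[ d ] d ∈ l′ × q ~ d
    dom′ q with dom q
    ... | inj₂ (inj₁ q∈) with keep q∈
    ...   | inj₁ q∈′ = inj₂ (inj₁ q∈′)
    ...   | inj₂ Rq  = inj₂ (dominate Rq (inj₁ refl))
    dom′ q | inj₂ (inj₂ (d , d∈ , q~d)) with keep d∈
    ...   | inj₁ d∈′ = inj₂ (inj₂ (d , d∈′ , q~d))
    ...   | inj₂ Rd  = inj₂ (dominate Rd (inj₂ q~d))
    att′ : ∀ w → w ∈ l′ → ∃[ d ] d ∈ l′ × d ≢ w × Near _~_ w d
    att′ w w∈′ with new w∈′
    ... | inj₂ h  = h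
    ... | inj₁ w∈ with att w w∈
    ... | d , d∈ , d≢w , w≈d with keep d∈
    ... | inj₁ d∈′ = d , d∈′ , d≢w , w≈d
    ... | inj₂ Rd  = attend Rd w∈ w∈′ w≈d

  -- For k + 1 = γₜ₂(G) this says that one contraction lowers γₜ₂.
  Drop : ℕ → Set
  Drop k = ∃[ u ] ∃[ v ] u ~ v × HasSTD G (merge u v) k

  module _
    (noP₅ : ∀ {a b c d e} → a ~ b → b ~ c → c ~ d → d ~ e →
            ¬ a ~ c → ¬ a ~ d → ¬ a ~ e → ¬ b ~ d → ¬ b ~ e → ¬ c ~ e → ⊥)
    (connected : ∀ u v → ∃[ k ] Walk G u v k)
    {k : ℕ} (l : List (Fin n)) (l≤ : length l ≤ suc k) (std : STD G whole l)
    (third : ∀ x y → x ∈ l → y ∈ l → ∃[ z ] z ∈ l × z ≢ x × z ≢ y)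
    where

    -- A walk from x to a third vertex of l leaves the region dominated by x and y
    -- along an edge whose far end is dominated by a third vertex.
    bridge : ∀ x y → x ∈ l → y ∈ l → ∃[ c ] (c ≡ x ⊎ c ≡ y) × ∃[ z ] z ∈ l × z ≢ x × z ≢ y ×
      (Near _~_ c z ⊎ ∃[ s ] ∃[ t ] c ~ s × s ~ t × t ~ z)
    bridge x y x∈ y∈ =
      let z , z∈ , z≢x , z≢y = third x y x∈ y∈
      in follow z∈ z≢x z≢y (inj₁ refl) (inj₁ refl) (proj₂ (connected x z))
      where
      -- Invariant: the current vertex p is c or a neighbour of c, where c is x or y. It can fail
      -- only at a next vertex that is a third member or is dominated by one.
      follow : ∀ {p z c j} → z ∈ l → z ≢ x → z ≢ y → c ≡ x ⊎ c ≡ y → p ≡ c ⊎ c ~ p → Walk G p z j →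
        ∃[ c ] (c ≡ x ⊎ c ≡ y) × ∃[ z ] z ∈ l × z ≢ x × z ≢ y ×
          (Near _~_ c z ⊎ ∃[ s ] ∃[ t ] c ~ s × s ~ t × t ~ z)
      follow z∈ z≢x z≢y (inj₁ refl) (inj₁ refl) stop = ⊥-elim (z≢x refl)
      follow z∈ z≢x z≢y (inj₂ refl) (inj₁ refl) stop = ⊥-elim (z≢y refl)
      follow z∈ z≢x z≢y core (inj₂ c~z) stop = _ , core , _ , z∈ , z≢x , z≢y , inj₁ (inj₁ c~z)
      follow {p} {c = c} z∈ z≢x z≢y core p≈c (step {v = q} p~q walk) with proj₁ std q
      ... | inj₂ (inj₁ q∈) with q Fin.≟ x | q Fin.≟ y
      ...   | yes q≡x | _       = follow z∈ z≢x z≢y (inj₁ q≡x) (inj₁ refl) walk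
      ...   | no _    | yes q≡y = follow z∈ z≢x z≢y (inj₂ q≡y) (inj₁ refl) walk
      ...   | no q≢x  | no q≢y  = c , core , q , q∈ , q≢x , q≢y , inj₁ (near p≈c)
        where
        near : p ≡ c ⊎ c ~ p → Near _~_ c q
        near (inj₁ refl) = inj₁ p~q
        near (inj₂ c~p)  = inj₂ (p , c~p , p~q)
      follow {p} {c = c} z∈ z≢x z≢y core p≈c (step {v = q} p~q walk)
          | inj₂ (inj₂ (d , d∈ , q~d)) with d Fin.≟ x | d Fin.≟ y
      ...   | yes d≡x | _       = follow z∈ z≢x z≢y (inj₁ d≡x) (inj₂ (symmetric q~d)) walk
      ...   | no _    | yes d≡y = follow z∈ z≢x z≢y (inj₂ d≡y) (inj₂ (symmetric q~d)) walk
      ...   | no d≢x  | no d≢y  = c , core , d , d∈ , d≢x , d≢y , near p≈c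
        where
        near : p ≡ c ⊎ c ~ p → Near _~_ c d ⊎ ∃[ s ] ∃[ t ] c ~ s × s ~ t × t ~ d
        near (inj₁ refl) = inj₁ (inj₂ (q , p~q , q~d))
        near (inj₂ c~p)  = inj₂ (p , q , c~p , p~q , q~d)

    -- Semitotal dominating sets that contain an edge

    module _ {x y} (x∈ : x ∈ l) (y∈ : y ∈ l) (x~y : x ~ y)
      (far : ∀ {w} → w ∈ l → w ≢ x → w ≢ y → ¬ Near _~_ x w × ¬ Near _~_ y w) where

      -- In the path y x a b z the only chord compatible with `far` is ya, so y ~ a. Then x is
      -- exchanged for a; the triple is y, a, z, where b joins a to z.
      drop-far : ∀ {a b z} → z ∈ l → z ≢ x → z ≢ y → x ~ a → a ~ b → b ~ z → Drop k
      drop-far {a} {b} {z} z∈ z≢x z≢y x~a a~b b~z =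
        y , a , y~a , friendly-triple y~a l′≤ std′ y∈′ (here refl) z∈′ z≢y z≢a (inj₂ (b , a~b , b~z))
        where
        x≁z : ¬ x ~ z
        x≁z = proj₁ (far z∈ z≢x z≢y) ∘ inj₁
        y≁z : ¬ y ~ z
        y≁z = proj₂ (far z∈ z≢x z≢y) ∘ inj₁
        a≁z : ¬ a ~ z
        a≁z a~z = proj₁ (far z∈ z≢x z≢y) (inj₂ (a , x~a , a~z))
        x≁b : ¬ x ~ b
        x≁b x~b = proj₁ (far z∈ z≢x z≢y) (inj₂ (b , x~b , b~z))
        y≁b : ¬ y ~ b
        y≁b y~b = proj₂ (far z∈ z≢x z≢y) (inj₂ (b , y~b , b~z))
        y~a : y ~ a
        y~a with y ~? a
        ... | yes y~a = y~a
        ... | no  y≁a = ⊥-elim (noP₅ (symmetric x~y) x~a a~b b~z y≁a y≁b y≁z x≁b x≁z a≁z)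
        z≢a : z ≢ a
        z≢a refl = x≁z x~a
        l′ : List (Fin n)
        l′ = a ∷ remove x l
        l′≤ : length l′ ≤ suc k
        l′≤ = ≤-trans (length-remove x∈) l≤
        y∈′ : y ∈ l′
        y∈′ = there (∈-remove⁺ y∈ (~-distinct x~y ∘ sym))
        z∈′ : z ∈ l′
        z∈′ = there (∈-remove⁺ z∈ z≢x)
        keep : ∀ {w} → w ∈ l → w ∈ l′ ⊎ w ≡ x
        keep {w} w∈ with w Fin.≟ x
        ... | yes w≡x = inj₂ w≡x
        ... | no  w≢x = inj₁ (there (∈-remove⁺ w∈ w≢x))
        dominate : ∀ {r q} → r ≡ x → q ≡ r ⊎ q ~ r → q ∈ l′ ⊎ ∃[ d ] d ∈ l′ × q ~ d
        dominate refl (inj₁ refl) = inj₂ (a , here refl , x~a)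
        dominate {q = q} refl (inj₂ q~x) with q ~? a | q ~? y | q ~? z
        ... | yes q~a | _ | _ = inj₂ (a , here refl , q~a)
        ... | no _ | yes q~y | _ = inj₂ (y , y∈′ , q~y)
        ... | no _ | no _ | yes q~z = inj₂ (z , z∈′ , q~z)
        -- A neighbour q of x missed by a, y and z yields an induced path: y x q b z if q ~ b, and q
        -- x a b z otherwise.
        ... | no q≁a | no q≁y | no q≁z with q ~? b
        ... | yes q~b = ⊥-elim (noP₅ (symmetric x~y) (symmetric q~x) q~b b~z (q≁y ∘ symmetric) y≁b y≁z x≁b x≁z q≁z)
        ... | no  q≁b = ⊥-elim (noP₅ q~x x~a a~b b~z q≁a q≁b q≁z x≁b x≁z a≁z)
        attend : ∀ {r w} → r ≡ x → w ∈ l → w ∈ l′ → Near _~_ w r → ∃[ d ] d ∈ l′ × d ≢ w × Near _~_ w d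
        attend {w = w} refl w∈ w∈′ w≈x with w Fin.≟ y
        ... | yes refl = a , here refl , ~-distinct y~a ∘ sym , inj₁ y~a
        ... | no  w≢y with w Fin.≟ x
        ... | yes refl = a , here refl , ~-distinct x~a ∘ sym , inj₁ x~a
        ... | no  w≢x  = ⊥-elim (proj₁ (far w∈ w≢x w≢y) (near-sym w≈x))
        new : ∀ {w} → w ∈ l′ → w ∈ l ⊎ ∃[ d ] d ∈ l′ × d ≢ w × Near _~_ w d
        new (here refl) = inj₂ (y , y∈′ , ~-distinct y~a , inj₁ (symmetric y~a))
        new (there w∈′) = inj₁ (proj₁ (∈-remove⁻ l w∈′))
        std′ : STD G whole l′
        std′ = exchange (_≡ x) std keep dominate attend new

    drop-near : ∀ {x y z} → x ∈ l → y ∈ l → z ∈ l → x ~ y → z ≢ x → z ≢ y → Near _~_ y z → Drop k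
    drop-near x∈ y∈ z∈ x~y z≢x z≢y y≈z = _ , _ , x~y , friendly-triple x~y l≤ std x∈ y∈ z∈ z≢x z≢y y≈z

    -- A third member within distance two of x or y completes a triple at once. Otherwise `bridge`
    -- supplies the path of length three that `drop-far` starts from.
    drop-edge : ∀ {x y} → x ∈ l → y ∈ l → x ~ y → Drop k
    drop-edge {x} {y} x∈ y∈ x~y
      with Any.any? (λ w → ¬? (w Fin.≟ x) ×-dec ¬? (w Fin.≟ y) ×-dec (near? x w ⊎-dec near? y w)) l
    ... | yes hit with find hit
    ...   | w , w∈ , w≢x , w≢y , inj₁ x≈w = drop-near y∈ x∈ w∈ (symmetric x~y) w≢y w≢x x≈w
    ...   | w , w∈ , w≢x , w≢y , inj₂ y≈w = drop-near x∈ y∈ w∈ x~y w≢x w≢y y≈w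
    drop-edge {x} {y} x∈ y∈ x~y | no miss with bridge x y x∈ y∈
    ... | c , core , z , z∈ , z≢x , z≢y , path = conclude core path
      where
      far : ∀ {w} → w ∈ l → w ≢ x → w ≢ y → ¬ Near _~_ x w × ¬ Near _~_ y w
      far w∈ w≢x w≢y = (λ nr → miss (lose w∈ (w≢x , w≢y , inj₁ nr))) , (λ nr → miss (lose w∈ (w≢x , w≢y , inj₂ nr)))
      far′ : ∀ {w} → w ∈ l → w ≢ y → w ≢ x → ¬ Near _~_ y w × ¬ Near _~_ x w
      far′ w∈ w≢y w≢x = let f , g = far w∈ w≢x w≢y in g , f
      conclude : c ≡ x ⊎ c ≡ y → Near _~_ c z ⊎ ∃[ s ] ∃[ t ] c ~ s × s ~ t × t ~ z → Drop k
      conclude (inj₁ refl) (inj₁ x≈z) = ⊥-elim (proj₁ (far z∈ z≢x z≢y) x≈z)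
      conclude (inj₂ refl) (inj₁ y≈z) = ⊥-elim (proj₂ (far z∈ z≢x z≢y) y≈z)
      conclude (inj₁ refl) (inj₂ (_ , _ , p , q , r)) = drop-far x∈ y∈ x~y far z∈ z≢x z≢y p q r
      conclude (inj₂ refl) (inj₂ (_ , _ , p , q , r)) = drop-far y∈ x∈ (symmetric x~y) far′ z∈ z≢y z≢x p q r

    -- Independent semitotal dominating sets

    module _ (indep : ∀ {x y} → x ∈ l → y ∈ l → ¬ x ~ y) where

      near-indep : ∀ {x y} → x ∈ l → y ∈ l → Near _~_ x y → ∃[ c ] x ~ c × c ~ y
      near-indep x∈ y∈ (inj₁ x~y) = ⊥-elim (indep x∈ y∈ x~y)
      near-indep x∈ y∈ (inj₂ h)   = h

      outside : ∀ {a x} → x ∈ l → a ~ x → ∀ {w} → w ∈ l → w ≢ a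
      outside x∈ a~x w∈ refl = indep w∈ x∈ a~x

      -- l − x + a
      drop-swap : ∀ {a x y z} → x ∈ l → y ∈ l → z ∈ l → x ≢ y → z ≢ x → z ≢ y → a ~ x → a ~ y → Near _~_ a z →
        (∀ q → q ~ x → q ~ a ⊎ ∃[ d ] d ∈ l × d ≢ x × q ~ d) → Drop k
      drop-swap {a} {x} {y} {z} x∈ y∈ z∈ x≢y z≢x z≢y a~x a~y a≈z covered =
        y , a , symmetric a~y , friendly-triple (symmetric a~y) l′≤ std′ y∈′ (here refl)
          (there (∈-remove⁺ z∈ z≢x)) z≢y (outside x∈ a~x z∈) a≈z
        where
        l′ : List (Fin n)
        l′ = a ∷ remove x l
        l′≤ : length l′ ≤ suc k
        l′≤ = ≤-trans (length-remove x∈) l≤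
        y∈′ : y ∈ l′
        y∈′ = there (∈-remove⁺ y∈ (x≢y ∘ sym))
        keep : ∀ {w} → w ∈ l → w ∈ l′ ⊎ w ≡ x
        keep {w} w∈ with w Fin.≟ x
        ... | yes w≡x = inj₂ w≡x
        ... | no  w≢x = inj₁ (there (∈-remove⁺ w∈ w≢x))
        dominate : ∀ {r q} → r ≡ x → q ≡ r ⊎ q ~ r → q ∈ l′ ⊎ ∃[ d ] d ∈ l′ × q ~ d
        dominate refl (inj₁ refl) = inj₂ (a , here refl , symmetric a~x)
        dominate {q = q} refl (inj₂ q~x) with covered q q~x
        ... | inj₁ q~a                  = inj₂ (a , here refl , q~a)
        ... | inj₂ (d , d∈ , d≢x , q~d) = inj₂ (d , there (∈-remove⁺ d∈ d≢x) , q~d)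
        attend : ∀ {r w} → r ≡ x → w ∈ l → w ∈ l′ → Near _~_ w r → ∃[ d ] d ∈ l′ × d ≢ w × Near _~_ w d
        attend {w = w} refl w∈ _ w≈x with near-indep w∈ x∈ w≈x
        ... | c , w~c , c~x with w ~? a | c ~? a | w Fin.≟ y | c ~? y
        ... | yes w~a | _ | _ | _ = a , here refl , outside x∈ a~x w∈ ∘ sym , inj₁ w~a
        ... | no _ | yes c~a | _ | _ = a , here refl , outside x∈ a~x w∈ ∘ sym , inj₂ (c , w~c , c~a)
        ... | no w≁a | no _ | yes refl | _ = ⊥-elim (w≁a (symmetric a~y))
        ... | no _ | no _ | no w≢y | yes c~y = y , y∈′ , w≢y ∘ sym , inj₂ (c , w~c , c~y)
        -- If neither a nor y can attend w, then w c x a y is an induced path.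
        ... | no w≁a | no c≁a | no _ | no c≁y =
          ⊥-elim (noP₅ w~c c~x (symmetric a~x) a~y (indep w∈ x∈) w≁a (indep w∈ y∈) c≁a c≁y (indep x∈ y∈))
        new : ∀ {w} → w ∈ l′ → w ∈ l ⊎ ∃[ d ] d ∈ l′ × d ≢ w × Near _~_ w d
        new (here refl) = inj₂ (y , y∈′ , ~-distinct a~y ∘ sym , inj₁ a~y)
        new (there w∈′) = inj₁ (proj₁ (∈-remove⁻ l w∈′))
        std′ : STD G whole l′
        std′ = exchange (_≡ x) std keep dominate attend new

      module _ (a b x y : Fin n) where

        -- l − x − y + a + b
        swap₂ : List (Fin n)
        swap₂ = a ∷ b ∷ remove x (remove y l)

        length-swap₂ : x ∈ l → y ∈ l → x ≢ y → length swap₂ ≤ suc k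
        length-swap₂ x∈ y∈ x≢y = ≤-trans (s≤s (length-remove (∈-remove⁺ x∈ x≢y))) (≤-trans (length-remove y∈) l≤)

        swap₂⁺ : ∀ {w} → w ∈ l → w ≢ x → w ≢ y → w ∈ swap₂
        swap₂⁺ w∈ w≢x w≢y = there (there (∈-remove⁺ (∈-remove⁺ w∈ w≢y) w≢x))

        swap₂-keep : ∀ {w} → w ∈ l → w ∈ swap₂ ⊎ (w ≡ x ⊎ w ≡ y)
        swap₂-keep {w} w∈ with w Fin.≟ x | w Fin.≟ y
        ... | yes w≡x | _       = inj₂ (inj₁ w≡x)
        ... | no _    | yes w≡y = inj₂ (inj₂ w≡y)
        ... | no w≢x  | no w≢y  = inj₁ (swap₂⁺ w∈ w≢x w≢y)

        swap₂⁻ : ∀ {w} → w ∈ swap₂ → w ≡ a ⊎ w ≡ b ⊎ w ∈ l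
        swap₂⁻ (here w≡a)          = inj₁ w≡a
        swap₂⁻ (there (here w≡b))  = inj₂ (inj₁ w≡b)
        swap₂⁻ (there (there w∈′)) = inj₂ (inj₂ (proj₁ (∈-remove⁻ l (proj₁ (∈-remove⁻ (remove y l) w∈′)))))

      -- Exchange x, y for a, b and contract ab, with z as third vertex. For r one of x, y, a
      -- neighbour q of r missed by a, b and z would give the induced path q r a b z.
      drop-pair : ∀ {a b x y z} → x ∈ l → y ∈ l → z ∈ l → x ≢ y → z ≢ x → z ≢ y →
        a ~ x → a ~ y → a ~ b → b ~ z → ¬ b ~ x → ¬ b ~ y → ¬ a ~ z → Drop k
      drop-pair {a} {b} {x} {y} {z} x∈ y∈ z∈ x≢y z≢x z≢y a~x a~y a~b b~z b≁x b≁y a≁z =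
        a , b , a~b , friendly-triple a~b (length-swap₂ a b x y x∈ y∈ x≢y) std′ (here refl) (there (here refl))
          z∈′ (outside x∈ a~x z∈) (outside z∈ b~z z∈) (inj₁ b~z)
        where
        l′ : List (Fin n)
        l′ = swap₂ a b x y
        z∈′ : z ∈ l′
        z∈′ = swap₂⁺ a b x y z∈ z≢x z≢y
        -- What x and y have in common, so that both removals are treated at once.
        R : Fin n → Set
        R r = r ∈ l × a ~ r × ¬ b ~ r
        keep : ∀ {w} → w ∈ l → w ∈ l′ ⊎ R w
        keep w∈ with swap₂-keep a b x y w∈
        ... | inj₁ w∈′         = inj₁ w∈′
        ... | inj₂ (inj₁ refl) = inj₂ (x∈ , a~x , b≁x)
        ... | inj₂ (inj₂ refl) = inj₂ (y∈ , a~y , b≁y)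
        dominate : ∀ {r q} → R r → q ≡ r ⊎ q ~ r → q ∈ l′ ⊎ ∃[ d ] d ∈ l′ × q ~ d
        dominate (r∈ , a~r , b≁r) (inj₁ refl) = inj₂ (a , here refl , symmetric a~r)
        dominate {q = q} (r∈ , a~r , b≁r) (inj₂ q~r) with q ~? a | q ~? b | q ~? z
        ... | yes q~a | _ | _ = inj₂ (a , here refl , q~a)
        ... | no _ | yes q~b | _ = inj₂ (b , there (here refl) , q~b)
        ... | no _ | no _ | yes q~z = inj₂ (z , z∈′ , q~z)
        ... | no q≁a | no q≁b | no q≁z =
          ⊥-elim (noP₅ q~r (symmetric a~r) a~b b~z q≁a q≁b q≁z (b≁r ∘ symmetric) (indep r∈ z∈) a≁z)
        attend : ∀ {r w} → R r → w ∈ l → w ∈ l′ → Near _~_ w r → ∃[ d ] d ∈ l′ × d ≢ w × Near _~_ w d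
        attend {w = w} (r∈ , a~r , b≁r) w∈ _ w≈r with near-indep w∈ r∈ w≈r
        ... | c , w~c , c~r with w ~? a | w ~? b | c ~? a | c ~? b
        ... | yes w~a | _ | _ | _ = a , here refl , outside x∈ a~x w∈ ∘ sym , inj₁ w~a
        ... | no _ | yes w~b | _ | _ = b , there (here refl) , outside z∈ b~z w∈ ∘ sym , inj₁ w~b
        ... | no _ | no _ | yes c~a | _ = a , here refl , outside x∈ a~x w∈ ∘ sym , inj₂ (c , w~c , c~a)
        ... | no _ | no _ | no _ | yes c~b = b , there (here refl) , outside z∈ b~z w∈ ∘ sym , inj₂ (c , w~c , c~b)
        -- If neither a nor b can attend w, then w c r a b is an induced path.
        ... | no w≁a | no w≁b | no c≁a | no c≁b =
          ⊥-elim (noP₅ w~c c~r (symmetric a~r) a~b (indep w∈ r∈) w≁a w≁b c≁a c≁b (b≁r ∘ symmetric))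
        new : ∀ {w} → w ∈ l′ → w ∈ l ⊎ ∃[ d ] d ∈ l′ × d ≢ w × Near _~_ w d
        new w∈′ with swap₂⁻ a b x y w∈′
        ... | inj₁ refl        = inj₂ (b , there (here refl) , ~-distinct a~b ∘ sym , inj₁ a~b)
        ... | inj₂ (inj₁ refl) = inj₂ (a , here refl , ~-distinct a~b , inj₁ (symmetric a~b))
        ... | inj₂ (inj₂ w∈)   = inj₁ w∈
        std′ : STD G whole l′
        std′ = exchange R std keep dominate attend new

      -- If every neighbour of x is adjacent to a, y or z, then x is exchanged for a. Otherwise some
      -- neighbour p of x is adjacent to none of them, and y, z are exchanged for a, p with the
      -- triple a, x, p. For r one of y, z, a neighbour q of r missed by a, p and x would give the
      -- induced path q r a x p.
      drop-claw : ∀ {a x y z} → x ∈ l → y ∈ l → z ∈ l → x ≢ y → z ≢ x → z ≢ y → a ~ x → a ~ y → a ~ z → Drop k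
      drop-claw {a} {x} {y} {z} x∈ y∈ z∈ x≢y z≢x z≢y a~x a~y a~z
        with any? (λ p → (p ~? x) ×-dec ¬? (p ~? a) ×-dec ¬? (p ~? y) ×-dec ¬? (p ~? z))
      ... | no none = drop-swap x∈ y∈ z∈ x≢y z≢x z≢y a~x a~y (inj₁ a~z) covered
        where
        covered : ∀ q → q ~ x → q ~ a ⊎ ∃[ d ] d ∈ l × d ≢ x × q ~ d
        covered q q~x with q ~? a | q ~? y | q ~? z
        ... | yes q~a | _ | _ = inj₁ q~a
        ... | no _ | yes q~y | _ = inj₂ (y , y∈ , x≢y ∘ sym , q~y)
        ... | no _ | no _ | yes q~z = inj₂ (z , z∈ , z≢x , q~z)
        ... | no q≁a | no q≁y | no q≁z = ⊥-elim (none (q , q~x , q≁a , q≁y , q≁z))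
      ... | yes (p , p~x , p≁a , p≁y , p≁z) =
        a , x , a~x , friendly-triple a~x (length-swap₂ a p y z y∈ z∈ y≢z) std′ (here refl) x∈′ (there (here refl))
          (λ { refl → p≁y a~y }) (~-distinct p~x) (inj₁ (symmetric p~x))
        where
        y≢z : y ≢ z
        y≢z = z≢y ∘ sym
        l′ : List (Fin n)
        l′ = swap₂ a p y z
        x∈′ : x ∈ l′
        x∈′ = swap₂⁺ a p y z x∈ x≢y (z≢x ∘ sym)
        R : Fin n → Set
        R r = r ∈ l × a ~ r × ¬ p ~ r
        keep : ∀ {w} → w ∈ l → w ∈ l′ ⊎ R w
        keep w∈ with swap₂-keep a p y z w∈
        ... | inj₁ w∈′         = inj₁ w∈′
        ... | inj₂ (inj₁ refl) = inj₂ (y∈ , a~y , p≁y)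
        ... | inj₂ (inj₂ refl) = inj₂ (z∈ , a~z , p≁z)
        dominate : ∀ {r q} → R r → q ≡ r ⊎ q ~ r → q ∈ l′ ⊎ ∃[ d ] d ∈ l′ × q ~ d
        dominate (r∈ , a~r , p≁r) (inj₁ refl) = inj₂ (a , here refl , symmetric a~r)
        dominate {q = q} (r∈ , a~r , p≁r) (inj₂ q~r) with q ~? a | q ~? p | q ~? x
        ... | yes q~a | _ | _ = inj₂ (a , here refl , q~a)
        ... | no _ | yes q~p | _ = inj₂ (p , there (here refl) , q~p)
        ... | no _ | no _ | yes q~x = inj₂ (x , x∈′ , q~x)
        ... | no q≁a | no q≁p | no q≁x =
          ⊥-elim (noP₅ q~r (symmetric a~r) a~x (symmetric p~x) q≁a q≁x q≁p (indep r∈ x∈) (p≁r ∘ symmetric) (p≁a ∘ symmetric))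
        attend : ∀ {r w} → R r → w ∈ l → w ∈ l′ → Near _~_ w r → ∃[ d ] d ∈ l′ × d ≢ w × Near _~_ w d
        attend {w = w} (r∈ , a~r , _) w∈ _ w≈r with near-indep w∈ r∈ w≈r
        ... | c , w~c , c~r with w ~? a | c ~? a | w Fin.≟ x | c ~? x
        ... | yes w~a | _ | _ | _ = a , here refl , outside x∈ a~x w∈ ∘ sym , inj₁ w~a
        ... | no _ | yes c~a | _ | _ = a , here refl , outside x∈ a~x w∈ ∘ sym , inj₂ (c , w~c , c~a)
        ... | no w≁a | no _ | yes refl | _ = ⊥-elim (w≁a (symmetric a~x))
        ... | no _ | no _ | no w≢x | yes c~x = x , x∈′ , w≢x ∘ sym , inj₂ (c , w~c , c~x)
        ... | no w≁a | no c≁a | no _ | no c≁x =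
          ⊥-elim (noP₅ w~c c~r (symmetric a~r) a~x (indep w∈ r∈) w≁a (indep w∈ x∈) c≁a c≁x (indep r∈ x∈))
        new : ∀ {w} → w ∈ l′ → w ∈ l ⊎ ∃[ d ] d ∈ l′ × d ≢ w × Near _~_ w d
        new w∈′ with swap₂⁻ a p y z w∈′
        ... | inj₁ refl        = inj₂ (x , x∈′ , ~-distinct a~x ∘ sym , inj₁ a~x)
        ... | inj₂ (inj₁ refl) = inj₂ (x , x∈′ , ~-distinct p~x ∘ sym , inj₁ p~x)
        ... | inj₂ (inj₂ w∈)   = inj₁ w∈
        std′ : STD G whole l′
        std′ = exchange R std keep dominate attend new

      -- Outside the claw cases the path z m x a y forces m ~ a. Then z is exchanged for m, unless z
      -- has a neighbour r missed by m, x and y. In that case the path r z m a y forces a ~ r, and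
      -- x, y are exchanged for a, r.
      drop-two-pairs : ∀ {a m x y z} → x ∈ l → y ∈ l → z ∈ l → x ≢ y → z ≢ x → z ≢ y →
        a ~ x → a ~ y → x ~ m → m ~ z → Drop k
      drop-two-pairs {a} {m} {x} {y} {z} x∈ y∈ z∈ x≢y z≢x z≢y a~x a~y x~m m~z with m ~? y | a ~? z | m ~? a
      ... | yes m~y | _ | _ = drop-claw x∈ y∈ z∈ x≢y z≢x z≢y (symmetric x~m) m~y m~z
      ... | no _ | yes a~z | _ = drop-claw x∈ y∈ z∈ x≢y z≢x z≢y a~x a~y a~z
      ... | no m≁y | no a≁z | no m≁a = ⊥-elim (noP₅ (symmetric m~z) (symmetric x~m) (symmetric a~x) a~y
        (indep z∈ x∈) (a≁z ∘ symmetric) (indep z∈ y∈) m≁a m≁y (indep x∈ y∈))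
      ... | no m≁y | no a≁z | yes m~a
        with any? (λ r → (r ~? z) ×-dec ¬? (r ~? m) ×-dec ¬? (r ~? x) ×-dec ¬? (r ~? y))
      ... | no none = drop-swap z∈ x∈ y∈ z≢x (z≢y ∘ sym) (x≢y ∘ sym) m~z (symmetric x~m) (inj₂ (a , m~a , a~y)) covered
        where
        covered : ∀ q → q ~ z → q ~ m ⊎ ∃[ d ] d ∈ l × d ≢ z × q ~ d
        covered q q~z with q ~? m | q ~? x | q ~? y
        ... | yes q~m | _ | _ = inj₁ q~m
        ... | no _ | yes q~x | _ = inj₂ (x , x∈ , z≢x ∘ sym , q~x)
        ... | no _ | no _ | yes q~y = inj₂ (y , y∈ , z≢y ∘ sym , q~y)
        ... | no q≁m | no q≁x | no q≁y = ⊥-elim (none (q , q~z , q≁m , q≁x , q≁y))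
      ... | yes (r , r~z , r≁m , r≁x , r≁y) with a ~? r
      ... | yes a~r = drop-pair x∈ y∈ z∈ x≢y z≢x z≢y a~x a~y a~r r~z r≁x r≁y a≁z
      ... | no  a≁r = ⊥-elim (noP₅ r~z (symmetric m~z) m~a a~y
        r≁m (a≁r ∘ symmetric) r≁y (a≁z ∘ symmetric) (indep z∈ y∈) m≁y)

      -- The chords tx, ty, sz and az lead back to two pairs or a claw, and sy or at to `drop-pair`.
      -- What remains contains an induced path: y a s t z if a ~ s, and y a x s t otherwise.
      drop-path : ∀ {a x y z s t} → x ∈ l → y ∈ l → z ∈ l → x ≢ y → z ≢ x → z ≢ y →
        a ~ x → a ~ y → x ~ s → s ~ t → t ~ z → Drop k
      drop-path {a} {x} {y} {z} {s} {t} x∈ y∈ z∈ x≢y z≢x z≢y a~x a~y x~s s~t t~z with t ~? x | t ~? y | s ~? z | a ~? z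
      ... | yes t~x | _ | _ | _ = drop-two-pairs x∈ y∈ z∈ x≢y z≢x z≢y a~x a~y (symmetric t~x) t~z
      ... | no _ | yes t~y | _ | _ = drop-two-pairs y∈ x∈ z∈ (x≢y ∘ sym) z≢y z≢x a~y a~x (symmetric t~y) t~z
      ... | no _ | no _ | yes s~z | _ = drop-two-pairs x∈ y∈ z∈ x≢y z≢x z≢y a~x a~y x~s s~z
      ... | no _ | no _ | no _ | yes a~z = drop-claw x∈ y∈ z∈ x≢y z≢x z≢y a~x a~y a~z
      ... | no t≁x | no t≁y | no s≁z | no a≁z with s ~? y | a ~? t | a ~? s
      ... | yes s~y | _ | _ = drop-pair x∈ y∈ z∈ x≢y z≢x z≢y (symmetric x~s) s~y s~t t~z t≁x t≁y s≁z
      ... | no _ | yes a~t | _ = drop-pair x∈ y∈ z∈ x≢y z≢x z≢y a~x a~y a~t t~z t≁x t≁y a≁z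
      ... | no s≁y | no a≁t | yes a~s = ⊥-elim (noP₅ (symmetric a~y) a~s s~t t~z
        (s≁y ∘ symmetric) (t≁y ∘ symmetric) (indep y∈ z∈) a≁t a≁z s≁z)
      ... | no s≁y | no a≁t | no a≁s = ⊥-elim (noP₅ (symmetric a~y) a~x x~s s~t
        (indep y∈ x∈) (s≁y ∘ symmetric) (t≁y ∘ symmetric) a≁s a≁t (t≁x ∘ symmetric))

      drop-independent : ∀ {x} → x ∈ l → Drop k
      drop-independent {x} x∈ with proj₂ std x x∈
      ... | y , y∈ , y≢x , x≈y with near-indep x∈ y∈ x≈y | bridge x y x∈ y∈
      ... | a , x~a , a~y | c , core , z , z∈ , z≢x , z≢y , path = conclude core path
        where
        conclude : c ≡ x ⊎ c ≡ y → Near _~_ c z ⊎ ∃[ s ] ∃[ t ] c ~ s × s ~ t × t ~ z → Drop k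
        conclude (inj₁ refl) (inj₁ x≈z) = let m , p , q = near-indep x∈ z∈ x≈z in
          drop-two-pairs x∈ y∈ z∈ (y≢x ∘ sym) z≢x z≢y (symmetric x~a) a~y p q
        conclude (inj₂ refl) (inj₁ y≈z) = let m , p , q = near-indep y∈ z∈ y≈z in
          drop-two-pairs y∈ x∈ z∈ y≢x z≢y z≢x a~y (symmetric x~a) p q
        conclude (inj₁ refl) (inj₂ (_ , _ , p , q , r)) =
          drop-path x∈ y∈ z∈ (y≢x ∘ sym) z≢x z≢y (symmetric x~a) a~y p q r
        conclude (inj₂ refl) (inj₂ (_ , _ , p , q , r)) =
          drop-path y∈ x∈ z∈ y≢x z≢y z≢x a~y (symmetric x~a) p q r

    drop : ∀ {x} → x ∈ l → Drop k
    drop x∈ with Any.any? (λ u → Any.any? (u ~?_) l) l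
    ... | yes hit = let u , u∈ , hit′ = find hit ; v , v∈ , u~v = find hit′ in drop-edge u∈ v∈ u~v
    ... | no miss = drop-independent (λ u∈ v∈ u~v → miss (lose u∈ (lose v∈ u~v))) x∈

-- Induced copies of P₅ + tK₁

⇔-true : ∀ {A : Set} → A → ⊤ ⇔ A
⇔-true p = mk⇔ (λ _ → p) (λ _ → tt)

⇔-false : ∀ {A : Set} → ¬ A → ⊥ ⇔ A
⇔-false ¬p = mk⇔ (λ ()) ¬p

module _ {n} (G : Graph n) where

  open Graph G
  open DecMembership {A = Fin n} Fin._≟_ using (_∈?_)

  record InducedP₅ : Set where
    field
      {a b c d e} : Fin n
      a~b : a ~ b
      b~c : b ~ c
      c~d : c ~ d
      d~e : d ~ e
      a≁c : ¬ a ~ c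
      a≁d : ¬ a ~ d
      a≁e : ¬ a ~ e
      b≁d : ¬ b ~ d
      b≁e : ¬ b ~ e
      c≁e : ¬ c ~ e

    vertex : Fin 5 → Fin n
    vertex = lookup (a ∷ b ∷ c ∷ d ∷ e ∷ [])

    vertex-adj : ∀ i j → Graph._~_ (pathGraph 5) i j ⇔ vertex i ~ vertex j
    vertex-adj zero zero = ⇔-false (irreflexive a)
    vertex-adj zero (suc zero) = ⇔-true a~b
    vertex-adj zero (suc (suc zero)) = ⇔-false a≁c
    vertex-adj zero (suc (suc (suc zero))) = ⇔-false a≁d
    vertex-adj zero (suc (suc (suc (suc zero)))) = ⇔-false a≁e
    vertex-adj (suc zero) zero = ⇔-true (symmetric a~b)
    vertex-adj (suc zero) (suc zero) = ⇔-false (irreflexive b)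
    vertex-adj (suc zero) (suc (suc zero)) = ⇔-true b~c
    vertex-adj (suc zero) (suc (suc (suc zero))) = ⇔-false b≁d
    vertex-adj (suc zero) (suc (suc (suc (suc zero)))) = ⇔-false b≁e
    vertex-adj (suc (suc zero)) zero = ⇔-false (a≁c ∘ symmetric)
    vertex-adj (suc (suc zero)) (suc zero) = ⇔-true (symmetric b~c)
    vertex-adj (suc (suc zero)) (suc (suc zero)) = ⇔-false (irreflexive c)
    vertex-adj (suc (suc zero)) (suc (suc (suc zero))) = ⇔-true c~d
    vertex-adj (suc (suc zero)) (suc (suc (suc (suc zero)))) = ⇔-false c≁e
    vertex-adj (suc (suc (suc zero))) zero = ⇔-false (a≁d ∘ symmetric)
    vertex-adj (suc (suc (suc zero))) (suc zero) = ⇔-false (b≁d ∘ symmetric)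
    vertex-adj (suc (suc (suc zero))) (suc (suc zero)) = ⇔-true (symmetric c~d)
    vertex-adj (suc (suc (suc zero))) (suc (suc (suc zero))) = ⇔-false (irreflexive d)
    vertex-adj (suc (suc (suc zero))) (suc (suc (suc (suc zero)))) = ⇔-true d~e
    vertex-adj (suc (suc (suc (suc zero)))) zero = ⇔-false (a≁e ∘ symmetric)
    vertex-adj (suc (suc (suc (suc zero)))) (suc zero) = ⇔-false (b≁e ∘ symmetric)
    vertex-adj (suc (suc (suc (suc zero)))) (suc (suc zero)) = ⇔-false (c≁e ∘ symmetric)
    vertex-adj (suc (suc (suc (suc zero)))) (suc (suc (suc zero))) = ⇔-true (symmetric d~e)
    vertex-adj (suc (suc (suc (suc zero)))) (suc (suc (suc (suc zero)))) = ⇔-false (irreflexive e)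

    -- No two vertices of P₅ have the same neighbours.
    vertex-injective : ∀ i j → vertex i ≡ vertex j → i ≡ j
    vertex-injective i j e = twins i j λ k →
      (λ p → from (vertex-adj j k) (subst (_~ vertex k) e (to (vertex-adj i k) p))) ,
      (λ p → from (vertex-adj i k) (subst (_~ vertex k) (sym e) (to (vertex-adj j k) p)))
      where
      open Equivalence
      _~ᵖ_ = Graph._~_ (pathGraph 5)
      _~ᵖ?_ = Graph._~?_ (pathGraph 5)
      separates? : ∀ i j → Dec (i ≡ j ⊎ ∃[ k ] ((i ~ᵖ k × ¬ j ~ᵖ k) ⊎ (j ~ᵖ k × ¬ i ~ᵖ k)))
      separates? i j = (i Fin.≟ j) ⊎-dec any? λ k →
        ((i ~ᵖ? k) ×-dec ¬? (j ~ᵖ? k)) ⊎-dec ((j ~ᵖ? k) ×-dec ¬? (i ~ᵖ? k))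
      -- A finite check on the 25 pairs, settled by evaluation.
      separated : ∀ i j → i ≡ j ⊎ ∃[ k ] ((i ~ᵖ k × ¬ j ~ᵖ k) ⊎ (j ~ᵖ k × ¬ i ~ᵖ k))
      separated = toWitness {a? = all? λ i → all? λ j → separates? i j} tt
      twins : ∀ i j → (∀ k → (i ~ᵖ k → j ~ᵖ k) × (j ~ᵖ k → i ~ᵖ k)) → i ≡ j
      twins i j same with separated i j
      ... | inj₁ i≡j                   = i≡j
      ... | inj₂ (k , inj₁ (p , ¬q)) = ⊥-elim (¬q (proj₁ (same k) p))
      ... | inj₂ (k , inj₂ (p , ¬q)) = ⊥-elim (¬q (proj₂ (same k) p))

  module _ (P : InducedP₅) where

    open InducedP₅ P using (vertex; vertex-adj; vertex-injective)

    -- In the field names g stands for `vertex`.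
    record Isolated {s} (h : Fin s → Fin n) : Set where
      field
        injective : ∀ i j → h i ≡ h j → i ≡ j
        h≁h       : ∀ i j → ¬ h i ~ h j
        g≢h       : ∀ i j → vertex i ≢ h j
        g≁h       : ∀ i j → ¬ vertex i ~ h j

    induced : ∀ {t} {h : Fin t → Fin n} → Isolated h → InducedSubgraph (P₅+ t K₁) G
    induced {t} {h} iso = f ∘ splitAt 5 , injective′ , adjacency
      where
      open Isolated iso
      f : Fin 5 ⊎ Fin t → Fin n
      f = [ vertex , h ]′
      f-injective : ∀ X Y → f X ≡ f Y → X ≡ Y
      f-injective (inj₁ i) (inj₁ j) e = cong inj₁ (vertex-injective i j e)
      f-injective (inj₁ i) (inj₂ j) e = ⊥-elim (g≢h i j e)
      f-injective (inj₂ i) (inj₁ j) e = ⊥-elim (g≢h j i (sym e))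
      f-injective (inj₂ i) (inj₂ j) e = cong inj₂ (injective i j e)
      injective′ : Injective _≡_ _≡_ (f ∘ splitAt 5)
      injective′ {i} {j} e =
        trans (sym (join-splitAt 5 t i)) (trans (cong (join 5 t) (f-injective (splitAt 5 i) (splitAt 5 j) e)) (join-splitAt 5 t j))
      _~ˢ_ = Pointwise (Graph._~_ (pathGraph 5)) (Graph._~_ (edgeless t))
      to : ∀ {X Y} → X ~ˢ Y → f X ~ f Y
      to (inj₁ p) = Equivalence.to (vertex-adj _ _) p
      from : ∀ X Y → f X ~ f Y → X ~ˢ Y
      from (inj₁ i) (inj₁ j) p = inj₁ (Equivalence.from (vertex-adj i j) p)
      from (inj₁ i) (inj₂ j) p = ⊥-elim (g≁h i j p)
      from (inj₂ i) (inj₁ j) p = ⊥-elim (g≁h j i (symmetric p))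
      from (inj₂ i) (inj₂ j) p = ⊥-elim (h≁h i j p)
      _~ˢ?_ = ⊎-decidable (Graph._~?_ (pathGraph 5)) (Graph._~?_ (edgeless t))
      adjacency : ∀ i j → Graph._~_ (P₅+ t K₁) i j ⇔ f (splitAt 5 i) ~ f (splitAt 5 j)
      adjacency i j = mk⇔
        (λ p → to (toWitness {a? = splitAt 5 i ~ˢ? splitAt 5 j} p))
        (λ p → fromWitness {a? = splitAt 5 i ~ˢ? splitAt 5 j} (from _ _ p))

  Dominating : List (Fin n) → Set
  Dominating A = ∀ x → x ∈ A ⊎ ∃[ w ] w ∈ A × x ~ w

  dominated? : ∀ A x → Dec (x ∈ A ⊎ ∃[ w ] w ∈ A × x ~ w)
  dominated? A x with x ∈? A | Any.any? (x ~?_) A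
  ... | yes x∈ | _     = yes (inj₁ x∈)
  ... | no _   | yes p = yes (inj₂ (find p))
  ... | no x∉  | no ¬p = no λ { (inj₁ x∈) → x∉ x∈ ; (inj₂ (_ , w∈ , x~w)) → ¬p (lose w∈ x~w) }

  module _ (nbr : ∀ x → ∃[ y ] x ~ y) where

    -- A vertex of A and its chosen neighbour serve as partners of each other.
    double : ∀ {A} → Dominating A → HasSTD G whole (length A + length A)
    double {A} dom = A ++ map ν A ,
      ≤-reflexive (trans (length-++ A) (cong (length A +_) (length-map ν A))) , dom′ , att′
      where
      ν : Fin n → Fin n
      ν = proj₁ ∘ nbr
      dom′ : ∀ x → ⊥ ⊎ x ∈ A ++ map ν A ⊎ ∃[ w ] w ∈ A ++ map ν A × x ~ w
      dom′ x with dom x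
      ... | inj₁ x∈             = inj₂ (inj₁ (∈-++⁺ˡ x∈))
      ... | inj₂ (w , w∈ , x~w) = inj₂ (inj₂ (w , ∈-++⁺ˡ w∈ , x~w))
      att′ : ∀ x → x ∈ A ++ map ν A → ∃[ w ] w ∈ A ++ map ν A × w ≢ x × Near _~_ x w
      att′ x x∈ with ∈-++⁻ A x∈
      ... | inj₁ x∈A = let y , x~y = nbr x in
        y , ∈-++⁺ʳ A (∈-map⁺ ν x∈A) , ~-distinct G x~y ∘ sym , inj₁ x~y
      ... | inj₂ x∈νA with ∈-map⁻ ν x∈νA
      ... | y , y∈ , refl = y , ∈-++⁺ˡ y∈ , ~-distinct G (proj₂ (nbr y)) , inj₁ (symmetric (proj₂ (nbr y)))

    module _ {t : ℕ} (¬small : ¬ HasSTD G whole (2 * (4 + t))) (P : InducedP₅) where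

      open InducedP₅ P using (vertex)

      -- If A were dominating, then doubling it would contradict `¬small`.
      undominated : ∀ {A} → length A ≤ 4 + t → ∃[ v ] ¬ (v ∈ A ⊎ ∃[ w ] w ∈ A × v ~ w)
      undominated {A} A≤ = ¬∀⟶∃¬ n _ (dominated? A) λ dom →
        let l , l≤ , std = double dom
        in ¬small (l , ≤-trans l≤ (+-mono-≤ A≤ (≤-trans A≤ (m≤m+n (4 + t) 0))) , std)

      -- The 5 + s vertices found so far do not dominate G, so another isolated vertex can be added.
      isolated : ∀ s → s ≤ t → ∃[ h ] Isolated P {s} h
      isolated zero    _   = (λ ()) , record { injective = λ () ; h≁h = λ () ; g≢h = λ _ () ; g≁h = λ _ () }
      isolated (suc s) s<t with isolated s (<⇒≤ s<t)
      -- There are 5 + s vertices so far, and 5 + s ≤ 4 + t is just s < t.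
      ... | h , iso with undominated {tabulate vertex ++ tabulate h}
        (subst (_≤ 4 + t) (sym (cong (5 +_) (length-tabulate h))) (s≤s (s≤s (s≤s (s≤s s<t)))))
      ... | v , ¬dom = h′ , record { injective = injective′ ; h≁h = h≁h′ ; g≢h = g≢h′ ; g≁h = g≁h′ }
        where
        open Isolated iso
        h′ : Fin (suc s) → Fin n
        h′ zero    = v
        h′ (suc j) = h j
        h∈ : ∀ j → h j ∈ tabulate vertex ++ tabulate h
        h∈ j = ∈-++⁺ʳ (tabulate vertex) (∈-tabulate⁺ j)
        g∈ : ∀ i → vertex i ∈ tabulate vertex ++ tabulate h
        g∈ i = ∈-++⁺ˡ (∈-tabulate⁺ {f = vertex} i)
        v≢ : ∀ {x} → x ∈ tabulate vertex ++ tabulate h → x ≢ v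
        v≢ x∈ refl = ¬dom (inj₁ x∈)
        v≁ : ∀ {x} → x ∈ tabulate vertex ++ tabulate h → ¬ v ~ x
        v≁ x∈ v~x = ¬dom (inj₂ (_ , x∈ , v~x))
        injective′ : ∀ i j → h′ i ≡ h′ j → i ≡ j
        injective′ zero    zero    _ = refl
        injective′ zero    (suc j) e = ⊥-elim (v≢ (h∈ j) (sym e))
        injective′ (suc i) zero    e = ⊥-elim (v≢ (h∈ i) e)
        injective′ (suc i) (suc j) e = cong suc (injective i j e)
        h≁h′ : ∀ i j → ¬ h′ i ~ h′ j
        h≁h′ zero    zero    = irreflexive v
        h≁h′ zero    (suc j) = v≁ (h∈ j)
        h≁h′ (suc i) zero    = v≁ (h∈ i) ∘ symmetric
        h≁h′ (suc i) (suc j) = h≁h i j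
        g≢h′ : ∀ i j → vertex i ≢ h′ j
        g≢h′ i zero    = v≢ (g∈ i)
        g≢h′ i (suc j) = g≢h i j
        g≁h′ : ∀ i j → ¬ vertex i ~ h′ j
        g≁h′ i zero    = v≁ (g∈ i) ∘ symmetric
        g≁h′ i (suc j) = g≁h i j

  module _ (connected : ∀ u v → ∃[ k ] Walk G u v k) {u v} (u~v : u ~ v) where

    neighbour : ∀ x → ∃[ y ] x ~ y
    neighbour x with connected x u
    ... | _ , stop       = v , u~v
    ... | _ , step x~y _ = _ , x~y

    -- A crude bound whose purpose is to show that γₜ₂(G) is defined.
    hasSTD : HasSTD G whole (length (allFin n) + length (allFin n))
    hasSTD = double neighbour (λ x → inj₁ (∈-allFin x))

    -- An induced P₅ would extend to P₅ + tK₁, so G is P₅-free and `drop` applies to a minimum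
    -- semitotal dominating set.
    large⇒1-EdgeContraction : ∀ {t} → Free (P₅+ t K₁) G → ¬ HasSTD G whole (2 * (4 + t)) → 1-EdgeContraction G
    large⇒1-EdgeContraction {t} free ¬small with smallest (hasSTD? G) _ hasSTD
    ... | zero , ([] , _ , dom , _) , _ with dom u
    ...   | inj₂ (inj₁ ())
    ...   | inj₂ (inj₂ (_ , () , _))
    large⇒1-EdgeContraction {t} free ¬small | suc k , (l , l≤ , std) , least with some-vertex
      where
      some-vertex : ∃[ x ] x ∈ l
      some-vertex with proj₁ std u
      ... | inj₂ (inj₁ u∈)           = u , u∈
      ... | inj₂ (inj₂ (w , w∈ , _)) = w , w∈
    ... | _ , x∈ with drop G noP₅ connected l l≤ std third x∈
      where
      noP₅ : ∀ {a b c d e} → a ~ b → b ~ c → c ~ d → d ~ e →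
             ¬ a ~ c → ¬ a ~ d → ¬ a ~ e → ¬ b ~ d → ¬ b ~ e → ¬ c ~ e → ⊥
      noP₅ a~b b~c c~d d~e a≁c a≁d a≁e b≁d b≁e c≁e =
        free (induced P (proj₂ (isolated neighbour {t} ¬small P t ≤-refl)))
        where
        P : InducedP₅
        P = record { a~b = a~b ; b~c = b~c ; c~d = c~d ; d~e = d~e ; a≁c = a≁c
                   ; a≁d = a≁d ; a≁e = a≁e ; b≁d = b≁d ; b≁e = b≁e ; c≁e = c≁e }
      -- If l had no members besides x and y, then these two alone would contradict `¬small`.
      third : ∀ x y → x ∈ l → y ∈ l → ∃[ z ] z ∈ l × z ≢ x × z ≢ y
      third x y x∈ y∈ with Any.any? (λ z → ¬? (z Fin.≟ x) ×-dec ¬? (z Fin.≟ y)) l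
      ... | yes hit = find hit
      ... | no miss = ⊥-elim (¬small (x ∷ y ∷ [] , s≤s (s≤s z≤n) , dom′ , att′))
        where
        to : ∀ {w} → w ∈ l → w ∈ x ∷ y ∷ []
        to {w} w∈ with w Fin.≟ x | w Fin.≟ y
        ... | yes w≡x | _       = here w≡x
        ... | no _    | yes w≡y = there (here w≡y)
        ... | no w≢x  | no w≢y  = ⊥-elim (miss (lose w∈ (w≢x , w≢y)))
        from : ∀ {w} → w ∈ x ∷ y ∷ [] → w ∈ l
        from (here refl)         = x∈
        from (there (here refl)) = y∈
        dom′ : ∀ q → ⊥ ⊎ q ∈ x ∷ y ∷ [] ⊎ ∃[ w ] w ∈ x ∷ y ∷ [] × q ~ w
        dom′ q with proj₁ std q
        ... | inj₂ (inj₁ q∈)             = inj₂ (inj₁ (to q∈))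
        ... | inj₂ (inj₂ (w , w∈ , q~w)) = inj₂ (inj₂ (w , to w∈ , q~w))
        att′ : ∀ q → q ∈ x ∷ y ∷ [] → ∃[ w ] w ∈ x ∷ y ∷ [] × w ≢ q × Near _~_ q w
        att′ q q∈ = let w , w∈ , rest = proj₂ std q (from q∈) in w , to w∈ , rest
    ... | u′ , v′ , u′~v′ , h =
      lowered⇒1-EdgeContraction u′~v′ h (λ hk → <-irrefl refl (least k hk)) hasSTD

-- The deciding sentence

sentence : ℕ → Formula 0
sentence K = ∃′ (∃′ (adj′ (suc zero) zero ∧′
  -- Index 1 is u and index 0 is v. This disjunct is the case γₜ₂(G) > K, where the edge uv already
  -- makes a graph of the class a yes-instance; the other one seeks k ≤ K with γₜ₂(G/uv) ≤ k <
  -- γₜ₂(G).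
  (¬′ hasSTDF K whole [] ∨′
   ⋁ (upTo (suc K)) (λ k → hasSTDF k (merge (suc zero) zero) [] ∧′ ¬′ hasSTDF k whole []))))

theorem15 : (t : ℕ) → PolyTimeSolvableOn (λ G → Connected G × Free (P₅+ t K₁) G) 1-EdgeContraction
theorem15 t = polyTime (sentence (2 * (4 + t))) λ G ((_ , connected) , free) → sound G connected free , complete G
  where
  K : ℕ
  K = 2 * (4 + t)
  sound : ∀ {n} (G : Graph n) → (∀ u v → ∃[ k ] Walk G u v k) → Free (P₅+ t K₁) G →
    ⟦ sentence K ⟧ G [] → 1-EdgeContraction G
  sound G connected free (u , v , u~v , inj₁ ¬small) =
    large⇒1-EdgeContraction G connected u~v free (¬small ∘ proj₂ (hasSTDF-sem G K _ whole))
  sound G connected free (u , v , u~v , inj₂ h) with ⋁-sound G (upTo (suc K)) h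
  ... | k , _ , p , ¬q = lowered⇒1-EdgeContraction u~v
    (proj₁ (hasSTDF-sem G k _ (merge (suc zero) zero)) p)
    (¬q ∘ proj₂ (hasSTDF-sem G k _ whole)) (hasSTD G connected u~v)
  complete : ∀ {n} (G : Graph n) → 1-EdgeContraction G → ⟦ sentence K ⟧ G []
  complete G Q with 1-EdgeContraction⇒lowered Q
  ... | u , v , u~v , k , p , ¬q = u , v , u~v , conclude
    where
    ρ : Vec _ 2
    ρ = v ∷ u ∷ []
    conclude : ⟦ ¬′ hasSTDF K whole [] ∨′
      ⋁ (upTo (suc K)) (λ k → hasSTDF k (merge (suc zero) zero) [] ∧′ ¬′ hasSTDF k whole []) ⟧ G ρ
    conclude with hasSTD? G K
    ... | no ¬small = inj₁ (¬small ∘ proj₁ (hasSTDF-sem G K ρ whole))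
    ... | yes (l , l≤K , std) = inj₂ (⋁-complete G (∈-upTo⁺ (s≤s k≤K))
      (proj₂ (hasSTDF-sem G k ρ (merge (suc zero) zero)) p , ¬q ∘ proj₁ (hasSTDF-sem G k ρ whole)))
      where
      -- G has a semitotal set of size at most K but none of size at most k, so k < K.
      k≤K : k ≤ K
      k≤K = <⇒≤ (≰⇒> λ K≤k → ¬q (l , ≤-trans l≤K K≤k , std))
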